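{- Let $A,B,B',C,C'\in\widehat{\mathbb{F}_q}$, $x,y\in\mathbb{F}_q$ and $t\in\mathbb{F}_q\setminus\{1\}$. Below, $\theta$ ranges over all multiplicative characters of $\mathbb{F}_q$. If $x\neq 1$, then $$\frac{1}{q-1}\sum_{\theta}\binom{B\overline{C}\theta}{\theta}F_{2}(A;B\theta,B';C,C';x,y)\,\theta(t)=\varepsilon(t)\,\overline{B}(1-t)\,F_{2}\left(A;B,B';C,C';\frac{x}{1-t},y\right)$$ $$\qquad-\overline{B}C(-t)\,\varepsilon(x)\,\overline{A}(1-x)\,{}_{2}F_1\left(\begin{matrix}A,B'\\ C'\end{matrix}\bigg|\,\frac{y}{1-x}\right).$$ If $y\neq 1$, then $$\frac{1}{q-1}\sum_{\theta}\binom{B'\overline{C'}\theta}{\theta}F_{2}(A;B,B'\theta;C,C';x,y)\,\theta(t)=\varepsilon(t)\,\overline{B'}(1-t)\,F_{2}\left(A;B,B';C,C';x,\frac{y}{1-t}\right)$$ $$\qquad-\overline{B'}C'(-t)\,\varepsilon(y)\,\overline{A}(1-y)\,{}_{2}F_1\left(\begin{matrix}A,B\\ C\end{matrix}\bigg|\,\frac{x}{1-y}\right).$$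
   Context: Let $q$ be a power of a prime, $\mathbb{F}_q$ the field with $q$ elements, and $\widehat{\mathbb{F}_q}$ the group of (complex-valued) multiplicative characters of $\mathbb{F}_q^*$. Every character $\chi$, including the trivial character $\varepsilon$, is extended to $\mathbb{F}_q$ by $\chi(0)=0$. $\overline{\chi}$ denotes the inverse of $\chi$. Products of characters are evaluated pointwise, e.g. $\overline{B}C(-t)=\overline{B}(-t)C(-t)$. Jacobi sum: $J(\chi,\lambda)=\sum_{u\in\mathbb{F}_q}\chi(u)\lambda(1-u)$. Binomial coefficient of characters: $\binom{A}{B}=B(-1)J(A,\overline{B})$. Finite field ${}_2F_1$: for $A,B,C\in\widehat{\mathbb{F}_q}$ and $x\in\mathbb{F}_q$, $${}_{2}F_1\left(\begin{matrix}A,B\\ C\end{matrix}\bigg|\,x\right)=\varepsilon(x)\,BC(-1)\sum_{u\in\mathbb{F}_q}B(u)\,\overline{B}C(1-u)\,\overline{A}(1-xu).$$ The finite field Appell series $F_2$ is defined, for $A,B,B',C,C'\in\widehat{\mathbb{F}_q}$ and $x,y\in\mathbb{F}_q$, by $$F_{2}(A;B,B';C,C';x,y)=\varepsilon(xy)\,BB'CC'(-1)\sum_{u,v\in\mathbb{F}_q}B(u)B'(v)\,\overline{B}C(1-u)\,\overline{B'}C'(1-v)\,\overline{A}(1-ux-vy).$$ -}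

module Defs where

open import Level using (Level; _⊔_) renaming (suc to lsuc)
open import Data.Nat.Base as ℕ using (ℕ; suc; NonZero; _∸_)
import Data.Nat.Properties as ℕ
open import Data.Nat.Primality using (Prime; prime⇒nonTrivial)
open import Data.Fin.Base using (Fin; toℕ)
import Data.Fin.Properties as Fin
open import Data.Product.Base using (∃-syntax; _,_; proj₁; proj₂)
open import Function.Bundles using (Inverse)
open import Relation.Binary.Bundles using (Setoid)
open import Relation.Binary.Definitions using (Decidable)
open import Relation.Binary.PropositionalEquality.Core as ≡ using (_≡_)
import Relation.Binary.PropositionalEquality.Properties as ≡
open import Relation.Nullary.Decidable.Core using (Dec; yes; no; map′; decidable-stable)
open import Relation.Nullary.Negation.Core using (¬_; contradiction)
open import Algebra.Bundles using (CommutativeRing)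
open import Algebra.Apartness.Bundles using (HeytingField)
open import Algebra.Morphism.Structures using (module MonoidMorphisms)
import Algebra.Apartness.Properties.HeytingCommutativeRing as HeytingProperties
import Algebra.Properties.Semiring.Exp as Exp
import Algebra.Properties.Monoid.Mult as Mult
import Algebra.Properties.Monoid.Sum as Sum
import Algebra.Properties.CommutativeSemigroup as CommutativeSemigroupProperties
import Relation.Binary.Reasoning.Setoid as ≈-Reasoning

private variable
  a b c ℓ₁ ℓ₂ k ℓ₃ ℓ₄ : Level

-- A listing of the elements of a setoid, each exactly once up to its equality.
Enumeration : Setoid a b → ℕ → Set (a ⊔ b)
Enumeration S n = Inverse S (≡.setoid (Fin n))

record FiniteField c ℓ₁ ℓ₂ : Set (lsuc (c ⊔ ℓ₁ ⊔ ℓ₂)) where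
  field
    heytingField : HeytingField c ℓ₁ ℓ₂
    p e          : ℕ
    p-prime      : Prime p
    e-nonZero    : NonZero e

  open HeytingField heytingField public

  commutativeRing : CommutativeRing c ℓ₁
  commutativeRing = record { isCommutativeRing = isCommutativeRing }

  open CommutativeRing commutativeRing public
    using (*-rawMonoid; *-commutativeSemigroup)

  q : ℕ
  q = p ℕ.^ e

  field
    elements : Enumeration setoid q

  module Elements = Inverse elements

  element : Fin q → Carrier
  element = Elements.from

  1<q : 1 ℕ.< q
  1<q = ℕ.^-monoʳ-< p (ℕ.nonTrivial⇒n>1 p {{prime⇒nonTrivial p-prime}})
                      (ℕ.>-nonZero⁻¹ e {{e-nonZero}})

  q-1-nonZero : NonZero (q ∸ 1)
  q-1-nonZero = ℕ.>-nonZero (ℕ.m<n⇒0<n∸m 1<q)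

  infix 4 _≟_

  _≟_ : Decidable _≈_
  x ≟ y = map′ (λ i≡j → trans (sym (Elements.strictlyInverseʳ x))
                          (trans (Elements.from-cong i≡j) (Elements.strictlyInverseʳ y)))
               Elements.to-cong
               (Elements.to x Fin.≟ Elements.to y)

  -- The multiplicative inverse, made total by the convention 0⁻¹ = 0
  -- (see recip-zero and recip-inverse).
  recip : Carrier → Carrier
  recip x with Fin.any? (λ i → x * element i ≟ 1#)
  ... | yes (i , _) = element i
  ... | no _        = 0#

  infixl 7 _÷_

  _÷_ : Carrier → Carrier → Carrier
  x ÷ y = x * recip y

  private
    module P = HeytingProperties heytingCommutativeRing
    module CR = CommutativeRing commutativeRing
    open CommutativeSemigroupProperties *-commutativeSemigroup using (interchange)

  1≉0 : ¬ 1# ≈ 0#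
  1≉0 1≈0 = #-irrefl 1≈0 P.1#0

  recip-unique : ∀ {x y} → x * y ≈ 1# → recip x ≈ y
  recip-unique {x} {y} xy≈1 with Fin.any? (λ i → x * element i ≟ 1#)
  ... | yes (i , xz≈1) = begin
      z            ≈⟨ *-identityʳ z ⟨
      z * 1#       ≈⟨ *-congˡ xy≈1 ⟨
      z * (x * y)  ≈⟨ *-assoc z x y ⟨
      z * x * y    ≈⟨ *-congʳ (*-comm z x) ⟩
      x * z * y    ≈⟨ *-congʳ xz≈1 ⟩
      1# * y       ≈⟨ *-identityˡ y ⟩
      y            ∎
    where
    open ≈-Reasoning setoid
    z = element i
  ... | no ∄z = contradiction
    (Elements.to y , trans (*-congˡ (Elements.strictlyInverseʳ y)) xy≈1) ∄z

  recip-zero : ∀ {x} → x ≈ 0# → recip x ≈ 0#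
  recip-zero {x} x≈0 with Fin.any? (λ i → x * element i ≟ 1#)
  ... | yes (i , xz≈1) = contradiction
    (trans (sym xz≈1) (trans (*-congʳ x≈0) (CR.zeroˡ (element i)))) 1≉0
  ... | no _ = refl

  recip-inverse : ∀ {x} → ¬ x ≈ 0# → x * recip x ≈ 1#
  recip-inverse {x} x≉0 = decidable-stable (x * recip x ≟ 1#) λ xx⁻¹≉1 →
    x≉0 (tight x 0# .proj₁ λ x#0 →
      let (y , _ , [x-0]y≈1) = #⇒invertible x#0
          xy≈1 = trans (*-congʳ (sym (P.x-0≈x x))) [x-0]y≈1
      in xx⁻¹≉1 (trans (*-congˡ (recip-unique xy≈1)) xy≈1))

  recip-cong : ∀ {x y} → x ≈ y → recip x ≈ recip y
  recip-cong {x} {y} x≈y with y ≟ 0#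
  ... | yes y≈0 = trans (recip-zero (trans x≈y y≈0)) (sym (recip-zero y≈0))
  ... | no y≉0  = recip-unique (trans (*-congʳ x≈y) (recip-inverse y≉0))

  x≉0∧y≉0⇒xy≉0 : ∀ {x y} → ¬ x ≈ 0# → ¬ y ≈ 0# → ¬ x * y ≈ 0#
  x≉0∧y≉0⇒xy≉0 {x} {y} x≉0 y≉0 xy≈0 = y≉0 (begin
      y                  ≈⟨ *-identityˡ y ⟨
      1# * y             ≈⟨ *-congʳ (recip-inverse x≉0) ⟨
      x * recip x * y    ≈⟨ *-congʳ (*-comm x (recip x)) ⟩
      recip x * x * y    ≈⟨ *-assoc (recip x) x y ⟩
      recip x * (x * y)  ≈⟨ *-congˡ xy≈0 ⟩
      recip x * 0#       ≈⟨ CR.zeroʳ (recip x) ⟩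
      0#                 ∎)
    where open ≈-Reasoning setoid

  recip-* : ∀ x y → recip (x * y) ≈ recip x * recip y
  recip-* x y with x ≟ 0# | y ≟ 0#
  ... | yes x≈0 | _ = trans (recip-zero (trans (*-congʳ x≈0) (CR.zeroˡ y)))
                            (sym (trans (*-congʳ (recip-zero x≈0)) (CR.zeroˡ (recip y))))
  ... | no _ | yes y≈0 = trans (recip-zero (trans (*-congˡ y≈0) (CR.zeroʳ x)))
                               (sym (trans (*-congˡ (recip-zero y≈0)) (CR.zeroʳ (recip x))))
  ... | no x≉0 | no y≉0 = recip-unique
    (trans (interchange x y (recip x) (recip y))
      (trans (*-cong (recip-inverse x≉0) (recip-inverse y≉0)) (*-identityˡ 1#)))

-- An algebraically closed field of characteristic zero, standing for the field
-- ℂ of character values.  The classical ℂ is an instance (with # the negation of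
-- ≈), and so is the field of constructive complex numbers, where ≈ is not
-- decidable.
record ValueField k ℓ₃ ℓ₄ : Set (lsuc (k ⊔ ℓ₃ ⊔ ℓ₄)) where
  field
    heytingField : HeytingField k ℓ₃ ℓ₄

  open HeytingField heytingField public

  commutativeRing : CommutativeRing k ℓ₃
  commutativeRing = record { isCommutativeRing = isCommutativeRing }

  open CommutativeRing commutativeRing public
    using (semiring; +-monoid; *-rawMonoid; *-commutativeSemigroup)
  open Exp semiring public using (_^_)
  open Mult +-monoid public using (_×_)
  open Sum +-monoid public using (sum)

  field
    charZero            : ∀ n .{{_ : NonZero n}} → n × 1# # 0#
    algebraicallyClosed : ∀ n (a : Fin (suc n) → Carrier) →
      ∃[ z ] z ^ suc n + sum (λ i → a i * z ^ toℕ i) ≈ 0#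

  1/_ : ∀ n .{{_ : NonZero n}} → Carrier
  1/ n = #⇒invertible (charZero n) .proj₁

  1/-inverse : ∀ n .{{_ : NonZero n}} → (1/ n) * (n × 1#) ≈ 1#
  1/-inverse n = trans (*-congˡ (sym (HeytingProperties.x-0≈x heytingCommutativeRing (n × 1#))))
                       (#⇒invertible (charZero n) .proj₂ .proj₁)

  -- The sum of f over all elements of a finite setoid.
  sumOver : ∀ {S : Setoid a b} {n} → Enumeration S n → (Setoid.Carrier S → Carrier) → Carrier
  sumOver enum f = sum (λ i → f (Inverse.from enum i))

module Appell {c ℓ₁ ℓ₂ k ℓ₃ ℓ₄} (𝔽 : FiniteField c ℓ₁ ℓ₂) (𝕂 : ValueField k ℓ₃ ℓ₄) where

  module F = FiniteField 𝔽
  module K = ValueField 𝕂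

  private
    module FR = CommutativeRing F.commutativeRing
    module KR = CommutativeRing K.commutativeRing
    module KP = CommutativeSemigroupProperties K.*-commutativeSemigroup

  open MonoidMorphisms F.*-rawMonoid K.*-rawMonoid using (IsMonoidHomomorphism)

  -- A homomorphism from the multiplicative group of F to that of K, extended by
  -- zero, is the same thing as a homomorphism of multiplicative monoids F → K
  -- that sends 0 to 0: units of F are automatically sent to units of K.
  record Character : Set (c ⊔ ℓ₁ ⊔ k ⊔ ℓ₃) where
    field
      ⟦_⟧                  : F.Carrier → K.Carrier
      isMonoidHomomorphism : IsMonoidHomomorphism ⟦_⟧
      ⟦0⟧                  : ⟦_⟧ F.0# K.≈ K.0#

    open IsMonoidHomomorphism isMonoidHomomorphism public
      using (⟦⟧-cong; homo; ε-homo)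

  open Character public using (⟦_⟧)

  characters : Setoid (c ⊔ ℓ₁ ⊔ k ⊔ ℓ₃) (c ⊔ ℓ₃)
  characters = record
    { Carrier       = Character
    ; _≈_           = λ χ ψ → ∀ x → ⟦ χ ⟧ x K.≈ ⟦ ψ ⟧ x
    ; isEquivalence = record
      { refl  = λ _ → K.refl
      ; sym   = λ χ≈ψ x → K.sym (χ≈ψ x)
      ; trans = λ χ≈ψ ψ≈ω x → K.trans (χ≈ψ x) (ψ≈ω x)
      }
    }

  private
    character : (f : F.Carrier → K.Carrier) →
                (∀ {x y} → x F.≈ y → f x K.≈ f y) →
                (∀ x y → f (x F.* y) K.≈ f x K.* f y) →
                f F.1# K.≈ K.1# → f F.0# K.≈ K.0# → Character
    character f cong homo f1 f0 = record
      { ⟦_⟧                  = f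
      ; isMonoidHomomorphism = record
        { isMagmaHomomorphism = record
          { isRelHomomorphism = record { cong = cong }
          ; homo              = homo
          }
        ; ε-homo              = f1
        }
      ; ⟦0⟧                  = f0
      }

    indicator : ∀ {x} → Dec (x F.≈ F.0#) → K.Carrier
    indicator (yes _) = K.0#
    indicator (no _)  = K.1#

    ε-fun : F.Carrier → K.Carrier
    ε-fun x = indicator (x F.≟ F.0#)

    ε-cong : ∀ {x y} → x F.≈ y → ε-fun x K.≈ ε-fun y
    ε-cong {x} {y} x≈y with x F.≟ F.0# | y F.≟ F.0#
    ... | yes _   | yes _   = K.refl
    ... | no _    | no _    = K.refl
    ... | yes x≈0 | no y≉0  = contradiction (F.trans (F.sym x≈y) x≈0) y≉0
    ... | no x≉0  | yes y≈0 = contradiction (F.trans x≈y y≈0) x≉0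

    ε-* : ∀ x y → ε-fun (x F.* y) K.≈ ε-fun x K.* ε-fun y
    ε-* x y with x F.≟ F.0# | y F.≟ F.0# | x F.* y F.≟ F.0#
    ... | yes _   | _       | yes _    = K.sym (KR.zeroˡ _)
    ... | no _    | yes _   | yes _    = K.sym (KR.zeroʳ _)
    ... | no _    | no _    | no _     = K.sym (K.*-identityˡ _)
    ... | yes x≈0 | _       | no xy≉0  = contradiction (F.trans (F.*-congʳ x≈0) (FR.zeroˡ y)) xy≉0
    ... | no _    | yes y≈0 | no xy≉0  = contradiction (F.trans (F.*-congˡ y≈0) (FR.zeroʳ x)) xy≉0
    ... | no x≉0  | no y≉0  | yes xy≈0 = contradiction xy≈0 (F.x≉0∧y≉0⇒xy≉0 x≉0 y≉0)

    ε-1 : ε-fun F.1# K.≈ K.1#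
    ε-1 with F.1# F.≟ F.0#
    ... | yes 1≈0 = contradiction 1≈0 F.1≉0
    ... | no _    = K.refl

    ε-0 : ε-fun F.0# K.≈ K.0#
    ε-0 with F.0# F.≟ F.0#
    ... | yes _  = K.refl
    ... | no 0≉0 = contradiction F.refl 0≉0

  -- The trivial character: 0 at 0 and 1 elsewhere.
  ε : Character
  ε = character ε-fun ε-cong ε-* ε-1 ε-0

  infixl 7 _·_
  infix  8 _⁻¹

  _·_ : Character → Character → Character
  χ · ψ = character
    (λ x → ⟦ χ ⟧ x K.* ⟦ ψ ⟧ x)
    (λ x≈y → K.*-cong (χ.⟦⟧-cong x≈y) (ψ.⟦⟧-cong x≈y))
    (λ x y → K.trans (K.*-cong (χ.homo x y) (ψ.homo x y)) (KP.interchange _ _ _ _))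
    (K.trans (K.*-cong χ.ε-homo ψ.ε-homo) (K.*-identityˡ _))
    (K.trans (K.*-congʳ χ.⟦0⟧) (KR.zeroˡ _))
    where module χ = Character χ
          module ψ = Character ψ

  -- On nonzero x this is χ(x⁻¹) = χ(x)⁻¹, and at 0 it is χ(0) = 0.
  _⁻¹ : Character → Character
  χ ⁻¹ = character
    (λ x → ⟦ χ ⟧ (F.recip x))
    (λ x≈y → χ.⟦⟧-cong (F.recip-cong x≈y))
    (λ x y → K.trans (χ.⟦⟧-cong (F.recip-* x y)) (χ.homo _ _))
    (K.trans (χ.⟦⟧-cong (F.recip-unique (F.*-identityˡ F.1#))) χ.ε-homo)
    (K.trans (χ.⟦⟧-cong (F.recip-zero F.refl)) χ.⟦0⟧)
    where module χ = Character χ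

  ∑ᶠ : (F.Carrier → K.Carrier) → K.Carrier
  ∑ᶠ = K.sumOver F.elements

  infix 2 ∑ᶠ
  syntax ∑ᶠ (λ u → s) = ∑[ u ∈F] s

  -1ᶠ : F.Carrier
  -1ᶠ = F.- F.1#

  J : Character → Character → K.Carrier
  J χ ψ = ∑[ u ∈F] ⟦ χ ⟧ u K.* ⟦ ψ ⟧ (F.1# F.- u)

  binom : Character → Character → K.Carrier
  binom A B = ⟦ B ⟧ -1ᶠ K.* J A (B ⁻¹)

  ₂F₁ : (A B C : Character) → F.Carrier → K.Carrier
  ₂F₁ A B C x =
    ⟦ ε ⟧ x K.* ⟦ B · C ⟧ -1ᶠ K.*
    (∑[ u ∈F] ⟦ B ⟧ u K.* ⟦ B ⁻¹ · C ⟧ (F.1# F.- u) K.* ⟦ A ⁻¹ ⟧ (F.1# F.- x F.* u))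

  F₂ : (A B B′ C C′ : Character) → F.Carrier → F.Carrier → K.Carrier
  F₂ A B B′ C C′ x y =
    ⟦ ε ⟧ (x F.* y) K.* ⟦ B · B′ · C · C′ ⟧ -1ᶠ K.*
    (∑[ u ∈F] ∑[ v ∈F]
      ⟦ B ⟧ u K.* ⟦ B′ ⟧ v K.*
      ⟦ B ⁻¹ · C ⟧ (F.1# F.- u) K.* ⟦ B′ ⁻¹ · C′ ⟧ (F.1# F.- v) K.*
      ⟦ A ⁻¹ ⟧ (F.1# F.- u F.* x F.- v F.* y))

  1/[q-1] : K.Carrier
  1/[q-1] = K.1/_ (F.q ∸ 1) {{F.q-1-nonZero}}

{-# OPTIONS --safe #-}
module Submission where

-- Write θ(-1) F₂(A; Bθ, …) as an integral over u and expand the binomial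
-- coefficient as an integral over w.  The sum over θ then becomes the sum of
-- θ(a) with a = wut/((1-w)(1-u)), and orthogonality of characters leaves only
-- the solution w = (1-u)/(1-u(1-t)) of a = 1, which exists exactly when t and u
-- are nonzero and u is neither 1 nor 1/(1-t).  Completing the resulting sum by
-- its term at u = 1 and substituting u ↦ u(1-t) gives F₂(x/(1-t), y); the term
-- at u = 1 is the ₂F₁ that is subtracted.
--
-- Orthogonality needs a character with χ(a) ≠ 1 for every a ≠ 0, 1: send a to a
-- nontrivial root of unity and extend to F* one element g at a time, mapping g to
-- an m-th root of the value prescribed at g^m, where m is least such that g^m lies
-- in the subgroup reached so far.  The equality of 𝕂 is stable under double
-- negation, so all of this may be carried out classically.

open import Level using (Level; _⊔_; Lift; lift) renaming (suc to lsuc)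
open import Data.Nat.Base as ℕ using (ℕ; zero; suc)
import Data.Nat.Properties as ℕ
open import Data.Nat.Induction using (<-rec)
open import Data.Fin.Base using (Fin; zero; suc; toℕ; punchIn)
open import Data.Fin.Permutation using (Permutation)
import Data.Fin.Properties as Fin
open import Data.Product.Base using (∃-syntax; _×_; _,_; proj₁; proj₂)
open import Data.Sum.Base using (_⊎_; inj₁; inj₂)
open import Function.Base using (_∘_; id)
open import Function.Bundles using (Inverse)
import Function.Construct.Composition as Compose
import Function.Construct.Symmetry as Symmetry
open import Relation.Binary.Bundles using (Setoid)
open import Relation.Binary.PropositionalEquality.Core as ≡ using (_≡_)
import Relation.Binary.Reasoning.Setoid as ≈-Reasoning
open import Relation.Nullary.Decidable.Core using (Dec; yes; no)
open import Relation.Nullary.Negation.Core using (¬_; contradiction; ¬¬-map)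
open import Algebra.Bundles using (CommutativeRing)
import Algebra.Apartness.Properties.HeytingCommutativeRing as HeytingProperties
import Algebra.Properties.CommutativeSemigroup as CommutativeSemigroupProperties
import Algebra.Properties.CommutativeSemiring.Exp as Exp
import Algebra.Properties.Ring as RingProperties
import Algebra.Properties.Semiring.Sum as SemiringSum
import Algebra.Solver.CommutativeMonoid as CommutativeMonoidSolver
open import Defs

private variable
  a b c ℓ₁ ℓ₂ k ℓ₃ ℓ₄ : Level

-- Finite sums indexed by enumerated setoids.

module EnumerationSums {k ℓ₃ ℓ₄} (𝕂 : ValueField k ℓ₃ ℓ₄) where

  open ValueField 𝕂 renaming (_×_ to _×ⁿ_)
  open SemiringSum semiring hiding (sum)
  open ≈-Reasoning setoid

  sum-single : ∀ {n} (t : Fin n → Carrier) i → (∀ j → ¬ j ≡ i → t j ≈ 0#) → sum t ≈ t i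
  sum-single {suc n} t i t≈0 = begin
    sum t                             ≈⟨ sum-remove {i = i} t ⟩
    t i + sum (λ j → t (punchIn i j)) ≈⟨ +-congˡ (sum-cong-≋ λ j → t≈0 _ (Fin.punchInᵢ≢i i j)) ⟩
    t i + sum {n} (λ _ → 0#)          ≈⟨ +-congˡ (sum-replicate-zero n) ⟩
    t i + 0#                          ≈⟨ +-identityʳ (t i) ⟩
    t i                               ∎

  opaque
    -- Kept opaque so that the summand can be inferred from the type of a sum.
    ∑ : ∀ {S : Setoid a b} {n} → Enumeration S n → (Setoid.Carrier S → Carrier) → Carrier
    ∑ = sumOver

  module _ {S : Setoid a b} {n} (enum : Enumeration S n) where
    private
      module S = Setoid S
      module E = Inverse enum

    opaque
      unfolding ∑

      ∑≡sumOver : ∀ f → ∑ enum f ≡ sumOver enum f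
      ∑≡sumOver f = ≡.refl

      ∑-cong : ∀ {f g} → (∀ x → f x ≈ g x) → ∑ enum f ≈ ∑ enum g
      ∑-cong f≈g = sum-cong-≋ (λ i → f≈g (E.from i))

      ∑-distribˡ : ∀ c f → c * ∑ enum f ≈ ∑ enum (λ x → c * f x)
      ∑-distribˡ c f = *-distribˡ-sum c (f ∘ E.from)

      ∑-distribʳ : ∀ c f → ∑ enum f * c ≈ ∑ enum (λ x → f x * c)
      ∑-distribʳ c f = *-distribʳ-sum c (f ∘ E.from)

      ∑-+ : ∀ f g → ∑ enum (λ x → f x + g x) ≈ ∑ enum f + ∑ enum g
      ∑-+ f g = ∑-distrib-+ (f ∘ E.from) (g ∘ E.from)

      ∑-const : ∀ c → ∑ enum (λ _ → c) ≈ n ×ⁿ c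
      ∑-const c = sum-replicate n

      ∑-zero : ∀ {f} → (∀ x → f x ≈ 0#) → ∑ enum f ≈ 0#
      ∑-zero f≈0 = trans (∑-cong f≈0) (sum-replicate-zero n)

      -- Conjugating `σ` by the enumeration gives a permutation of the indices. Passing through the
      -- indices returns an element only up to the setoid equality, which `f-cong` absorbs.
      ∑-reindex : ∀ f → (∀ {x y} → x S.≈ y → f x ≈ f y) → (σ : Inverse S S) →
                  ∑ enum f ≈ ∑ enum (f ∘ Inverse.to σ)
      ∑-reindex f f-cong σ = begin
        ∑ enum f                        ≈⟨ sum-permute (f ∘ E.from) π ⟩
        sum (f ∘ E.from ∘ Inverse.to π) ≈⟨ sum-cong-≋ {n} (λ i → f-cong (E.strictlyInverseʳ (Inverse.to σ (E.from i)))) ⟩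
        ∑ enum (f ∘ Inverse.to σ)       ∎
        where
        π : Permutation n n
        π = Compose.inverse (Symmetry.inverse enum) (Compose.inverse σ enum)

      ∑-single : ∀ f → (∀ {x y} → x S.≈ y → f x ≈ f y) → ∀ x →
                 (∀ y → ¬ y S.≈ x → f y ≈ 0#) → ∑ enum f ≈ f x
      ∑-single f f-cong x f≈0 = begin
        ∑ enum f            ≈⟨ sum-single (f ∘ E.from) (E.to x) (λ j j≢ → f≈0 _ (λ eq →
                                 j≢ (≡.trans (≡.sym (E.strictlyInverseˡ j)) (E.to-cong eq)))) ⟩
        f (E.from (E.to x)) ≈⟨ f-cong (E.strictlyInverseʳ x) ⟩
        f x                 ∎

  opaque
    unfolding ∑

    ∑-swap : ∀ {a b a′ b′} {S : Setoid a b} {T : Setoid a′ b′} {m n}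
             (d : Enumeration S m) (e : Enumeration T n)
             (f : Setoid.Carrier S → Setoid.Carrier T → Carrier) →
             ∑ d (λ x → ∑ e (f x)) ≈ ∑ e (λ y → ∑ d (λ x → f x y))
    ∑-swap {m = m} {n} d e f = ∑-comm {m} {n} (λ i j → f (Inverse.from d i) (Inverse.from e j))

-- If there were no least witness, strong induction would refute `P` everywhere. The double negation
-- is there because `P` will be membership in the domain of a partial character, which is not
-- decided.
¬¬-least : ∀ {P : ℕ → Set a} {n} → P n → ¬ ¬ (∃[ m ] P m × (∀ {i} → i ℕ.< m → ¬ P i))
¬¬-least {P = P} {n} Pn ∄least = <-rec (λ m → ¬ P m) (λ m ih Pm → ∄least (m , Pm , ih)) n Pn

-- Stable equality, roots and roots of unity in the value field.

module ValueFieldProperties (𝕂 : ValueField k ℓ₃ ℓ₄) where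

  open ValueField 𝕂 renaming (_×_ to _×ⁿ_)
  open Exp (CommutativeRing.commutativeSemiring commutativeRing) using (^-congˡ)
  open SemiringSum semiring hiding (sum)
  open HeytingProperties heytingCommutativeRing using (x-0≈x)
  open RingProperties (CommutativeRing.ring commutativeRing) using (+-cancelˡ)
  open ≈-Reasoning setoid

  -- Tightness makes equality the negation of apartness, and negations are stable. This is what lets
  -- double-negated existence statements prove equations in `𝕂`.
  ≈-stable : ∀ {x y} → ¬ ¬ x ≈ y → x ≈ y
  ≈-stable {x} {y} ¬¬x≈y = tight x y .proj₁ λ x#y → ¬¬x≈y λ x≈y → tight x y .proj₂ x≈y x#y

  -- `¬ y ≈ 0#` does not directly yield an apartness, hence no inverse of `y`. As the conclusion is
  -- stable, `x` may be assumed nonzero; then an inverse of `y` is absurd, and tightness forces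
  -- `y ≈ 0#`.
  xy≈0∧y≉0⇒x≈0 : ∀ {x y} → x * y ≈ 0# → ¬ y ≈ 0# → x ≈ 0#
  xy≈0∧y≉0⇒x≈0 {x} {y} xy≈0 y≉0 = ≈-stable λ x≉0 → y≉0 (tight y 0# .proj₁ λ y#0 →
    let (z , _ , [y-0]z≈1) = #⇒invertible y#0 in x≉0 (begin
      x                  ≈⟨ *-identityʳ x ⟨
      x * 1#             ≈⟨ *-congˡ [y-0]z≈1 ⟨
      x * ((y - 0#) * z) ≈⟨ *-assoc x (y - 0#) z ⟨
      x * (y - 0#) * z   ≈⟨ *-congʳ (*-congˡ (x-0≈x y)) ⟩
      x * y * z          ≈⟨ *-congʳ xy≈0 ⟩
      0# * z             ≈⟨ zeroˡ z ⟩
      0#                 ∎))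

  -- Algebraic closure is applied to the monic polynomial with constant term `- w` and all other
  -- lower coefficients zero.
  root : ∀ n w → ∃[ z ] z ^ suc n ≈ w
  root n w = z , (begin
      z ^ suc n                      ≈⟨ +-identityʳ _ ⟨
      z ^ suc n + 0#                 ≈⟨ +-congˡ (-‿inverseˡ w) ⟨
      z ^ suc n + (- w + w)          ≈⟨ +-assoc _ _ _ ⟨
      z ^ suc n + - w + w            ≈⟨ +-congʳ (+-congˡ constant-term) ⟨
      z ^ suc n + sum (λ i → coefficient i * z ^ toℕ i) + w ≈⟨ +-congʳ z-root ⟩
      0# + w                         ≈⟨ +-identityˡ w ⟩
      w                              ∎)
    where
    coefficient : Fin (suc n) → Carrier
    coefficient zero    = - w
    coefficient (suc _) = 0#
    z      = algebraicallyClosed n coefficient .proj₁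
    z-root = algebraicallyClosed n coefficient .proj₂
    constant-term : sum (λ i → coefficient i * z ^ toℕ i) ≈ - w
    constant-term = begin
      - w * 1# + sum {n} (λ i → 0# * z ^ suc (toℕ i))
        ≈⟨ +-cong (*-identityʳ (- w)) (sum-cong-≋ {n} (λ i → zeroˡ (z ^ suc (toℕ i)))) ⟩
      - w + sum {n} (λ _ → 0#)  ≈⟨ +-congˡ (sum-replicate-zero n) ⟩
      - w + 0#                  ≈⟨ +-identityʳ (- w) ⟩
      - w                       ∎

  -- The identity (z - 1)(1 + ⋯ + zⁿ⁻¹) = zⁿ - 1 with the negative terms moved across, so that the
  -- induction involves no subtraction.
  geometric-sum : ∀ n z → z * sum {n} (λ i → z ^ toℕ i) + 1# ≈ sum {n} (λ i → z ^ toℕ i) + z ^ n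
  geometric-sum zero    z = +-congʳ (zeroʳ z)
  geometric-sum (suc n) z = begin
    z * (1# + sum {n} (λ i → z * z ^ toℕ i)) + 1#    ≈⟨ +-congʳ (*-congˡ tail≈) ⟩
    z * (z * s + 1#) + 1#      ≈⟨ +-congʳ (*-congˡ (geometric-sum n z)) ⟩
    z * (s + z ^ n) + 1#       ≈⟨ +-congʳ (distribˡ z s (z ^ n)) ⟩
    z * s + z ^ suc n + 1#     ≈⟨ +-assoc _ _ _ ⟩
    z * s + (z ^ suc n + 1#)   ≈⟨ +-congˡ (+-comm _ _) ⟩
    z * s + (1# + z ^ suc n)   ≈⟨ +-assoc _ _ _ ⟨
    z * s + 1# + z ^ suc n     ≈⟨ +-congʳ tail≈ ⟨
    1# + sum {n} (λ i → z * z ^ toℕ i) + z ^ suc n ∎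
    where
    s = sum {n} (λ i → z ^ toℕ i)
    tail≈ : 1# + sum {n} (λ i → z * z ^ toℕ i) ≈ z * s + 1#
    tail≈ = trans (+-congˡ (sym (*-distribˡ-sum {n} z (λ i → z ^ toℕ i)))) (+-comm _ _)

  -- A root of 1 + X + ⋯ + Xⁿ⁺¹ differs from 1 because n + 2 is nonzero in 𝕂.
  nontrivial-root-of-unity : ∀ n → ∃[ ζ ] ζ ^ suc (suc n) ≈ 1# × ¬ ζ ≈ 1#
  nontrivial-root-of-unity n = ζ , ζ^m≈1 , ζ≉1
    where
    m = suc n
    ζ = algebraicallyClosed n (λ _ → 1#) .proj₁
    s = sum {m} (λ i → ζ ^ toℕ i)
    root≈0 : ζ ^ m + s ≈ 0#
    root≈0 = trans (+-congˡ (sum-cong-≋ {m} (λ i → sym (*-identityˡ (ζ ^ toℕ i)))))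
                   (algebraicallyClosed n (λ _ → 1#) .proj₂)
    ζ^m≈1 : ζ ^ suc m ≈ 1#
    -- The root equation makes both `s + ζ ^ m` and its multiple by `ζ` vanish; the geometric sum
    -- turns the former into `ζ * s + 1#`.
    ζ^m≈1 = +-cancelˡ (ζ * s) _ _ (begin
      ζ * s + ζ * ζ ^ m ≈⟨ distribˡ ζ s (ζ ^ m) ⟨
      ζ * (s + ζ ^ m)   ≈⟨ *-congˡ (trans (+-comm _ _) root≈0) ⟩
      ζ * 0#            ≈⟨ zeroʳ ζ ⟩
      0#                ≈⟨ root≈0 ⟨
      ζ ^ m + s         ≈⟨ +-comm _ _ ⟩
      s + ζ ^ m         ≈⟨ geometric-sum m ζ ⟨
      ζ * s + 1#        ∎)
    1^n≈1 : ∀ i → 1# ^ i ≈ 1#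
    1^n≈1 zero    = refl
    1^n≈1 (suc i) = trans (*-identityˡ _) (1^n≈1 i)
    ζ≉1 : ¬ ζ ≈ 1#
    ζ≉1 ζ≈1 = tight (suc m ×ⁿ 1#) 0# .proj₂ (begin
      1# + m ×ⁿ 1#  ≈⟨ +-cong (power≈1 m) (trans (sum-cong-≋ {m} (λ i → power≈1 (toℕ i))) (sum-replicate m)) ⟨
      ζ ^ m + s    ≈⟨ root≈0 ⟩
      0#           ∎) (charZero (suc m))
      where
      power≈1 : ∀ i → ζ ^ i ≈ 1#
      power≈1 i = trans (^-congˡ i ζ≈1) (1^n≈1 i)

-- Characters separating the elements of the multiplicative group.

module Separation (𝔽 : FiniteField c ℓ₁ ℓ₂) (𝕂 : ValueField k ℓ₃ ℓ₄) where

  open Appell 𝔽 𝕂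
  open ValueFieldProperties 𝕂
  private
    module FR = CommutativeRing F.commutativeRing
    module KR = CommutativeRing K.commutativeRing
    module FP = CommutativeSemigroupProperties F.*-commutativeSemigroup
    module KP = CommutativeSemigroupProperties K.*-commutativeSemigroup
    module FE = Exp FR.commutativeSemiring
    module KE = Exp KR.commutativeSemiring
    open FE using () renaming (_^_ to _^ᶠ_)

  *-cancelˡ : ∀ {x y z} → ¬ x F.≈ F.0# → x F.* y F.≈ x F.* z → y F.≈ z
  *-cancelˡ {x} {y} {z} x≉0 xy≈xz = begin
      y                        ≈⟨ recip-x*x*y y ⟨
      F.recip x F.* (x F.* y)  ≈⟨ F.*-congˡ xy≈xz ⟩
      F.recip x F.* (x F.* z)  ≈⟨ recip-x*x*y z ⟩
      z                        ∎
    where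
    open ≈-Reasoning F.setoid
    recip-x*x*y : ∀ w → F.recip x F.* (x F.* w) F.≈ w
    recip-x*x*y w = begin
      F.recip x F.* (x F.* w)  ≈⟨ F.*-assoc _ _ _ ⟨
      F.recip x F.* x F.* w    ≈⟨ F.*-congʳ (F.*-comm _ _) ⟩
      x F.* F.recip x F.* w    ≈⟨ F.*-congʳ (F.recip-inverse x≉0) ⟩
      F.1# F.* w               ≈⟨ F.*-identityˡ w ⟩
      w                        ∎

  ^-nonzero : ∀ {g} → ¬ g F.≈ F.0# → ∀ n → ¬ g ^ᶠ n F.≈ F.0#
  ^-nonzero g≉0 zero    = F.1≉0
  ^-nonzero g≉0 (suc n) = F.x≉0∧y≉0⇒xy≉0 g≉0 (^-nonzero g≉0 n)

  -- Among the powers of `g` with exponents from 0 to q two coincide; cancelling the smaller power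
  -- leaves the exponent j - i, written as a successor to record that it is positive.
  finite-order : ∀ {g} → ¬ g F.≈ F.0# → ∃[ n ] g ^ᶠ suc n F.≈ F.1#
  finite-order {g} g≉0 = n , *-cancelˡ (^-nonzero g≉0 (toℕ i)) (begin
      g ^ᶠ toℕ i F.* g ^ᶠ suc n  ≈⟨ FE.^-homo-* g (toℕ i) (suc n) ⟨
      g ^ᶠ (toℕ i ℕ.+ suc n)     ≡⟨ ≡.cong (g ^ᶠ_) (≡.trans (ℕ.+-suc (toℕ i) n) (ℕ.m+[n∸m]≡n i<j)) ⟩
      g ^ᶠ toℕ j                 ≈⟨ F.trans (F.sym (F.Elements.strictlyInverseʳ _))
                                      (F.trans (F.Elements.from-cong (≡.sym g^i≡g^j)) (F.Elements.strictlyInverseʳ _)) ⟩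
      g ^ᶠ toℕ i                 ≈⟨ F.*-identityʳ _ ⟨
      g ^ᶠ toℕ i F.* F.1#        ∎)
    where
    open ≈-Reasoning F.setoid
    repetition = Fin.pigeonhole (ℕ.n<1+n F.q) (λ i → F.Elements.to (g ^ᶠ toℕ i))
    i = repetition .proj₁
    j = repetition .proj₂ .proj₁
    i<j = repetition .proj₂ .proj₂ .proj₁
    g^i≡g^j = repetition .proj₂ .proj₂ .proj₂
    n = toℕ j ℕ.∸ suc (toℕ i)

  -- The graph of a homomorphism from a subgroup of F* to K*.  Closure under
  -- inverses is automatic, since elements of F* have finite order.
  record PartialCharacter : Set (lsuc (c ⊔ ℓ₁ ⊔ k ⊔ ℓ₃)) where
    field
      Graph   : F.Carrier → K.Carrier → Set (c ⊔ ℓ₁ ⊔ k ⊔ ℓ₃)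
      resp    : ∀ {x y κ μ} → x F.≈ y → κ K.≈ μ → Graph x κ → Graph y μ
      unit    : Graph F.1# K.1#
      mult    : ∀ {x y κ μ} → Graph x κ → Graph y μ → Graph (x F.* y) (κ K.* μ)
      nonzero : ∀ {x κ} → Graph x κ → ¬ x F.≈ F.0#
      kernel  : ∀ {κ} → Graph F.1# κ → κ K.≈ K.1#

    Domain : F.Carrier → Set _
    Domain x = ∃[ κ ] Graph x κ

    power : ∀ {x κ} → Graph x κ → ∀ n → Graph (x ^ᶠ n) (κ K.^ n)
    power Rxκ zero    = unit
    power Rxκ (suc n) = mult Rxκ (power Rxκ n)

    -- If x^(n+1) = 1, then xⁿ inverts `x`, and `kernel` at x^(n+1) shows that its value κⁿ inverts
    -- `κ`.
    inverse : ∀ {x κ} → Graph x κ →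
              ∃[ y ] ∃[ μ ] Graph y μ × y F.* x F.≈ F.1# × μ K.* κ K.≈ K.1#
    inverse {x} {κ} Rxκ =
      let n , x^1+n≈1 = finite-order (nonzero Rxκ)
      in  x ^ᶠ n , κ K.^ n , power Rxκ n , F.trans (F.*-comm _ _) x^1+n≈1 ,
          K.trans (K.*-comm _ _) (kernel (resp x^1+n≈1 K.refl (power Rxκ (suc n))))

    -- `kernel` is single-valuedness at 1 only. Multiplying by the value `μ′` at the inverse of `x`
    -- moves the comparison there.
    functional : ∀ {x κ μ} → Graph x κ → Graph x μ → κ K.≈ μ
    functional {x} {κ} {μ} Rxκ Rxμ = begin
        κ                ≈⟨ K.*-identityʳ κ ⟨
        κ K.* K.1#       ≈⟨ K.*-congˡ μ′μ≈1 ⟨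
        κ K.* (μ′ K.* μ) ≈⟨ K.*-assoc κ μ′ μ ⟨
        κ K.* μ′ K.* μ   ≈⟨ K.*-congʳ (kernel (resp (F.trans (F.*-comm _ _) x′x≈1) K.refl (mult Rxκ Rx′μ′))) ⟩
        K.1# K.* μ       ≈⟨ K.*-identityˡ μ ⟩
        μ                ∎
      where
      open ≈-Reasoning K.setoid
      x⁻¹ = inverse Rxμ
      μ′ = x⁻¹ .proj₂ .proj₁
      Rx′μ′ = x⁻¹ .proj₂ .proj₂ .proj₁
      x′x≈1 = x⁻¹ .proj₂ .proj₂ .proj₂ .proj₁
      μ′μ≈1 = x⁻¹ .proj₂ .proj₂ .proj₂ .proj₂

  open PartialCharacter

  infix 4 _⊆_

  _⊆_ : PartialCharacter → PartialCharacter → Set _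
  R ⊆ R′ = ∀ {x κ} → Graph R x κ → Graph R′ x κ

  trivial : PartialCharacter
  trivial = record
    { Graph   = λ x κ → Lift (c ⊔ k) (x F.≈ F.1# × κ K.≈ K.1#)
    ; resp    = λ x≈y κ≈μ (lift (x≈1 , κ≈1)) →
                  lift (F.trans (F.sym x≈y) x≈1 , K.trans (K.sym κ≈μ) κ≈1)
    ; unit    = lift (F.refl , K.refl)
    ; mult    = λ (lift (x≈1 , κ≈1)) (lift (y≈1 , μ≈1)) →
                  lift (F.trans (F.*-cong x≈1 y≈1) (F.*-identityˡ _) ,
                        K.trans (K.*-cong κ≈1 μ≈1) (K.*-identityˡ _))
    ; nonzero = λ (lift (x≈1 , _)) x≈0 → F.1≉0 (F.trans (F.sym x≈1) x≈0)
    ; kernel  = λ (lift (_ , κ≈1)) → κ≈1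
    }

  module _ (R : PartialCharacter) {g} (g≉0 : ¬ g F.≈ F.0#) where

    -- The new graph consists of the pairs (y gⁱ, μ zⁱ) with `μ` a value at `y`. If y gⁱ = 1, then
    -- gⁱ is the inverse of `y` and so already has a value, inverse to `μ`; by `consistent` that
    -- value is zⁱ, hence μ zⁱ = 1.
    adjoin : ∀ z → (∀ i {κ} → Graph R (g ^ᶠ i) κ → κ K.≈ z K.^ i) →
             ∃[ R′ ] R ⊆ R′ × Graph R′ g z
    adjoin z consistent = R′ ,
        (λ {x} {κ} Rxκ → 0 , x , κ , Rxκ , F.sym (F.*-identityʳ x) , K.sym (K.*-identityʳ κ)) ,
        (1 , F.1# , K.1# , unit R , F.sym (F.trans (F.*-identityˡ _) (F.*-identityʳ g)) ,
         K.sym (K.trans (K.*-identityˡ _) (K.*-identityʳ z)))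
      where
      kernel′ : ∀ {i y μ κ} → Graph R y μ → F.1# F.≈ y F.* g ^ᶠ i → κ K.≈ μ K.* z K.^ i → κ K.≈ K.1#
      kernel′ {i} {y} {μ} {κ} Ryμ 1≈yg^i κ≈μz^i = begin
          κ              ≈⟨ κ≈μz^i ⟩
          μ K.* z K.^ i  ≈⟨ K.*-congˡ (consistent i (resp R y′≈g^i K.refl Ry′μ′)) ⟨
          μ K.* μ′       ≈⟨ K.*-comm μ μ′ ⟩
          μ′ K.* μ       ≈⟨ μ′μ≈1 ⟩
          K.1#           ∎
        where
        open ≈-Reasoning K.setoid
        y⁻¹ = inverse R Ryμ
        y′ = y⁻¹ .proj₁
        μ′ = y⁻¹ .proj₂ .proj₁
        Ry′μ′ = y⁻¹ .proj₂ .proj₂ .proj₁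
        y′y≈1 = y⁻¹ .proj₂ .proj₂ .proj₂ .proj₁
        μ′μ≈1 = y⁻¹ .proj₂ .proj₂ .proj₂ .proj₂
        y′≈g^i : y′ F.≈ g ^ᶠ i
        y′≈g^i = *-cancelˡ (nonzero R Ryμ) (F.trans (F.*-comm y y′) (F.trans y′y≈1 1≈yg^i))

      R′ : PartialCharacter
      R′ = record
        { Graph   = λ x κ → ∃[ i ] ∃[ y ] ∃[ μ ]
                      Graph R y μ × x F.≈ y F.* g ^ᶠ i × κ K.≈ μ K.* z K.^ i
        ; resp    = λ x≈x′ κ≈κ′ (i , y , μ , Ryμ , x≈ , κ≈) →
                      i , y , μ , Ryμ , F.trans (F.sym x≈x′) x≈ , K.trans (K.sym κ≈κ′) κ≈
        ; unit    = 0 , F.1# , K.1# , unit R , F.sym (F.*-identityˡ _) , K.sym (K.*-identityˡ _)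
        ; mult    = λ (i , y , μ , Ryμ , x≈ , κ≈) (j , y′ , μ′ , Ry′μ′ , x′≈ , κ′≈) →
                      i ℕ.+ j , y F.* y′ , μ K.* μ′ , mult R Ryμ Ry′μ′ ,
                      F.trans (F.*-cong x≈ x′≈)
                        (F.trans (FP.interchange _ _ _ _) (F.*-congˡ (F.sym (FE.^-homo-* g i j)))) ,
                      K.trans (K.*-cong κ≈ κ′≈)
                        (K.trans (KP.interchange _ _ _ _) (K.*-congˡ (K.sym (KE.^-homo-* z i j))))
        ; nonzero = λ (i , y , μ , Ryμ , x≈ , _) x≈0 →
                      F.x≉0∧y≉0⇒xy≉0 (nonzero R Ryμ) (^-nonzero g≉0 i) (F.trans (F.sym x≈) x≈0)
        ; kernel  = λ (i , y , μ , Ryμ , 1≈ , κ≈) → kernel′ {i} Ryμ 1≈ κ≈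
        }

    -- Consistency at every exponent follows from the least one, `suc m`, by strong induction: no
    -- positive exponent below it occurs, and a larger one is lowered by `suc m` on multiplying by
    -- the inverse of g^(m+1).
    adjoin-root : ∀ {m μ z} → Graph R (g ^ᶠ suc m) μ →
                  (∀ {i} → i ℕ.< m → ¬ Domain R (g ^ᶠ suc i)) → z K.^ suc m K.≈ μ →
                  ∃[ R′ ] R ⊆ R′ × Graph R′ g z
    adjoin-root {m} {μ} {z} Rg^mμ least z^m≈μ = adjoin z λ i → <-rec Consistent step i
      where
      Consistent : ℕ → Set _
      Consistent i = ∀ {κ} → Graph R (g ^ᶠ i) κ → κ K.≈ z K.^ i
      h = inverse R Rg^mμ
      y = h .proj₁
      μ′ = h .proj₂ .proj₁
      Ryμ′ = h .proj₂ .proj₂ .proj₁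
      yg^m≈1 = h .proj₂ .proj₂ .proj₂ .proj₁
      μ′μ≈1 = h .proj₂ .proj₂ .proj₂ .proj₂

      reduce : ∀ j → Consistent j → Consistent (suc m ℕ.+ j)
      reduce j ih {κ} Rg^iκ = begin
          κ                          ≈⟨ K.*-identityʳ κ ⟨
          κ K.* K.1#                 ≈⟨ K.*-congˡ μ′μ≈1 ⟨
          κ K.* (μ′ K.* μ)           ≈⟨ K.*-assoc κ μ′ μ ⟨
          κ K.* μ′ K.* μ             ≈⟨ K.*-congʳ (ih (resp R g^iy≈g^j K.refl (mult R Rg^iκ Ryμ′))) ⟩
          z K.^ j K.* μ              ≈⟨ K.*-congˡ z^m≈μ ⟨
          z K.^ j K.* z K.^ suc m    ≈⟨ K.*-comm _ _ ⟩
          z K.^ suc m K.* z K.^ j    ≈⟨ KE.^-homo-* z (suc m) j ⟨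
          z K.^ (suc m ℕ.+ j)        ∎
        where
        open ≈-Reasoning K.setoid
        g^iy≈g^j : g ^ᶠ (suc m ℕ.+ j) F.* y F.≈ g ^ᶠ j
        g^iy≈g^j = F.trans (F.*-congʳ (FE.^-homo-* g (suc m) j))
          (F.trans (FP.xy∙z≈zx∙y _ _ _) (F.trans (F.*-congʳ yg^m≈1) (F.*-identityˡ _)))

      step : ∀ i → (∀ {j} → j ℕ.< i → Consistent j) → Consistent i
      step zero    ih R1κ = kernel R R1κ
      -- Both exponents are shifted by one: `i < m` puts `suc i` below the least exponent `suc m`;
      -- otherwise i = m + j, and `reduce` goes down to `j`.
      step (suc i) ih R[g^1+i]κ with i ℕ.<? m
      ... | yes i<m = contradiction (_ , R[g^1+i]κ) (least i<m)
      ... | no i≮m with j , ≡.refl ← ℕ.m≤n⇒∃[o]m+o≡n (ℕ.≮⇒≥ i≮m) =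
        reduce j (ih (ℕ.s≤s (ℕ.m≤n+m j m))) R[g^1+i]κ

    -- Some positive power of `g` is 1 and thus in the domain, so a least such exponent exists, but
    -- only under double negation. The root of its value supplies the value at `g`.
    extend : ¬ ¬ (∃[ R′ ] R ⊆ R′ × Domain R′ g)
    extend ∄R′ =
      let n , g^1+n≈1 = finite-order g≉0
      in ¬¬-least {P = λ i → Domain R (g ^ᶠ suc i)} {n} (K.1# , resp R (F.sym g^1+n≈1) K.refl (unit R))
           λ (m , (μ , Rg^mμ) , least) →
             let z , z^m≈μ = root m μ
                 R′ , R⊆R′ , R′gz = adjoin-root Rg^mμ least z^m≈μ
             in ∄R′ (R′ , R⊆R′ , z , R′gz)

  -- Finitely many double-negated extensions compose to one. An arbitrary finite family `f` replaces
  -- the enumeration so that induction on its length applies.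
  extend-all : ∀ R n (f : Fin n → F.Carrier) →
               ¬ ¬ (∃[ R′ ] R ⊆ R′ × (∀ i → ¬ f i F.≈ F.0# → Domain R′ (f i)))
  extend-all R zero    f ∄R′ = ∄R′ (R , id , λ ())
  extend-all R (suc n) f ∄R′ = extend-all R n (f ∘ suc) λ (R₁ , R⊆R₁ , dom₁) → extend-head R₁ R⊆R₁ dom₁
    where
    extend-head : ∀ R₁ → R ⊆ R₁ → ¬ (∀ i → ¬ f (suc i) F.≈ F.0# → Domain R₁ (f (suc i)))
    extend-head R₁ R⊆R₁ dom₁ with f zero F.≟ F.0#
    ... | yes f0≈0 = ∄R′ (R₁ , R⊆R₁ , λ
      { zero f0≉0 → contradiction f0≈0 f0≉0 ; (suc i) fi≉0 → dom₁ i fi≉0 })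
    ... | no f0≉0 = extend R₁ f0≉0 λ (R₂ , R₁⊆R₂ , dom₂) → ∄R′ (R₂ , R₁⊆R₂ ∘ R⊆R₁ , λ
      { zero _ → dom₂ ; (suc i) fi≉0 → let κ , R₁fiκ = dom₁ i fi≉0 in κ , R₁⊆R₂ R₁fiκ })

  -- `Value` adds the pair (0, 0) to the graph and stays functional because the graph avoids zero.
  -- Values are chosen along the enumeration, and every law of a character then follows from
  -- functionality.
  total⇒character : ∀ R → (∀ i → ¬ F.element i F.≈ F.0# → Domain R (F.element i)) →
                    ∃[ χ ] (∀ {x κ} → Graph R x κ → ⟦ χ ⟧ x K.≈ κ)
  total⇒character R total = χ , λ {x} Rxκ → Value-functional (χ-value x) (inj₂ Rxκ)
    where
    Value : F.Carrier → K.Carrier → Set _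
    Value x κ = (x F.≈ F.0# × κ K.≈ K.0#) ⊎ Graph R x κ

    Value-resp : ∀ {x y κ} → x F.≈ y → Value x κ → Value y κ
    Value-resp x≈y (inj₁ (x≈0 , κ≈0)) = inj₁ (F.trans (F.sym x≈y) x≈0 , κ≈0)
    Value-resp x≈y (inj₂ Rxκ)         = inj₂ (resp R x≈y K.refl Rxκ)

    Value-functional : ∀ {x κ μ} → Value x κ → Value x μ → κ K.≈ μ
    Value-functional (inj₁ (_ , κ≈0)) (inj₁ (_ , μ≈0)) = K.trans κ≈0 (K.sym μ≈0)
    Value-functional (inj₁ (x≈0 , _)) (inj₂ Rxμ)       = contradiction x≈0 (nonzero R Rxμ)
    Value-functional (inj₂ Rxκ)       (inj₁ (x≈0 , _)) = contradiction x≈0 (nonzero R Rxκ)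
    Value-functional (inj₂ Rxκ)       (inj₂ Rxμ)       = functional R Rxκ Rxμ

    Value-mult : ∀ {x y κ μ} → Value x κ → Value y μ → Value (x F.* y) (κ K.* μ)
    Value-mult (inj₁ (x≈0 , κ≈0)) _ =
      inj₁ (F.trans (F.*-congʳ x≈0) (FR.zeroˡ _) , K.trans (K.*-congʳ κ≈0) (KR.zeroˡ _))
    Value-mult (inj₂ _) (inj₁ (y≈0 , μ≈0)) =
      inj₁ (F.trans (F.*-congˡ y≈0) (FR.zeroʳ _) , K.trans (K.*-congˡ μ≈0) (KR.zeroʳ _))
    Value-mult (inj₂ Rxκ) (inj₂ Ryμ) = inj₂ (mult R Rxκ Ryμ)

    value : ∀ i → ∃[ κ ] Value (F.element i) κ
    value i with F.element i F.≟ F.0#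
    ... | yes x≈0 = K.0# , inj₁ (x≈0 , K.refl)
    ... | no x≉0  = let κ , Rxκ = total i x≉0 in κ , inj₂ Rxκ

    fun : F.Carrier → K.Carrier
    fun x = value (F.Elements.to x) .proj₁

    χ-value : ∀ x → Value x (fun x)
    χ-value x = Value-resp (F.Elements.strictlyInverseʳ x) (value (F.Elements.to x) .proj₂)

    χ : Character
    χ = record
      { ⟦_⟧                  = fun
      ; isMonoidHomomorphism = record
        { isMagmaHomomorphism = record
          { isRelHomomorphism = record
            { cong = λ {x} {y} x≈y → Value-functional (Value-resp x≈y (χ-value x)) (χ-value y) }
          ; homo = λ x y → Value-functional (χ-value (x F.* y)) (Value-mult (χ-value x) (χ-value y))
          }
        ; ε-homo = Value-functional (χ-value F.1#) (inj₂ (unit R))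
        }
      ; ⟦0⟧                  = Value-functional (χ-value F.0#) (inj₁ (F.refl , K.refl))
      }

  -- Over the trivial subgroup, the least exponent that `adjoin-root` asks for is the order of `a`.
  -- The value at `a` survives all later extensions.
  separation : ∀ {a} → ¬ a F.≈ F.0# → ¬ a F.≈ F.1# → ¬ ¬ (∃[ χ ] ¬ ⟦ χ ⟧ a K.≈ K.1#)
  separation {a} a≉0 a≉1 ∄χ =
    ¬¬-least {P = λ i → Domain trivial (a ^ᶠ suc i)} {finite-order a≉0 .proj₁} (K.1# , lift (finite-order a≉0 .proj₂ , K.refl)) λ where
      -- Order one would mean `a ≈ 1`, so the order has the form `suc (suc m)`, as
      -- `nontrivial-root-of-unity` expects.
      (zero  , (_ , lift (a^1≈1 , _)) , _) → a≉1 (F.trans (F.sym (F.*-identityʳ a)) a^1≈1)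
      (suc m , (_ , lift (a^[2+m]≈1 , _)) , least) →
        let ζ , ζ^[2+m]≈1 , ζ≉1 = nontrivial-root-of-unity m
            R₁ , _ , R₁aζ = adjoin-root trivial a≉0 (lift (a^[2+m]≈1 , K.refl)) least ζ^[2+m]≈1
        in extend-all R₁ F.q F.element λ (R₂ , R₁⊆R₂ , total) →
             let χ , χ≈ = total⇒character R₂ total
             in ∄χ (χ , λ χa≈1 → ζ≉1 (K.trans (K.sym (χ≈ (R₁⊆R₂ R₁aζ))) χa≈1))

-- Character identities and the orthogonality relations.

module CharacterProperties (𝔽 : FiniteField c ℓ₁ ℓ₂) (𝕂 : ValueField k ℓ₃ ℓ₄) where

  open Appell 𝔽 𝕂
  open Character using (⟦⟧-cong; homo; ε-homo; ⟦0⟧)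
  open EnumerationSums 𝕂
  open ValueFieldProperties 𝕂
  open Separation 𝔽 𝕂
  private
    module FR = CommutativeRing F.commutativeRing
    module KR = CommutativeRing K.commutativeRing
    module FRP = RingProperties FR.ring
    module KRP = RingProperties KR.ring
  open ≈-Reasoning K.setoid

  x≉y⇒x-y≉0 : ∀ {x y} → ¬ x F.≈ y → ¬ x F.- y F.≈ F.0#
  x≉y⇒x-y≉0 {x} {y} x≉y x-y≈0 = x≉y (FRP.x∙y⁻¹≈ε⇒x≈y x y x-y≈0)

  ⟦≈0⟧ : ∀ χ {x} → x F.≈ F.0# → ⟦ χ ⟧ x K.≈ K.0#
  ⟦≈0⟧ χ x≈0 = K.trans (⟦⟧-cong χ x≈0) (⟦0⟧ χ)

  ⟦≈1⟧ : ∀ χ {x} → x F.≈ F.1# → ⟦ χ ⟧ x K.≈ K.1#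
  ⟦≈1⟧ χ x≈1 = K.trans (⟦⟧-cong χ x≈1) (ε-homo χ)

  ε-nonzero : ∀ {x} → ¬ x F.≈ F.0# → ⟦ ε ⟧ x K.≈ K.1#
  ε-nonzero {x} x≉0 with x F.≟ F.0#
  ... | yes x≈0 = contradiction x≈0 x≉0
  ... | no _    = K.refl

  ⁻¹-inverseˡ : ∀ χ {x} → ¬ x F.≈ F.0# → ⟦ χ ⁻¹ ⟧ x K.* ⟦ χ ⟧ x K.≈ K.1#
  ⁻¹-inverseˡ χ {x} x≉0 = begin
    ⟦ χ ⟧ (F.recip x) K.* ⟦ χ ⟧ x  ≈⟨ homo χ _ _ ⟨
    ⟦ χ ⟧ (F.recip x F.* x)        ≈⟨ ⟦≈1⟧ χ (F.trans (F.*-comm _ _) (F.recip-inverse x≉0)) ⟩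
    K.1#                           ∎

  ⁻¹-inverseʳ : ∀ χ {x} → ¬ x F.≈ F.0# → ⟦ χ ⟧ x K.* ⟦ χ ⁻¹ ⟧ x K.≈ K.1#
  ⁻¹-inverseʳ χ x≉0 = K.trans (K.*-comm _ _) (⁻¹-inverseˡ χ x≉0)

  ε-identityˡ : ∀ χ x → ⟦ ε ⟧ x K.* ⟦ χ ⟧ x K.≈ ⟦ χ ⟧ x
  ε-identityˡ χ x with x F.≟ F.0#
  ... | yes x≈0 = K.trans (KR.zeroˡ _) (K.sym (⟦≈0⟧ χ x≈0))
  ... | no _    = K.*-identityˡ _

  -- Inverse characters multiply to `ε` and not to the constant one, but at zero both sides vanish.
  cancel-·ˡ : ∀ χ ψ {x} → (¬ x F.≈ F.0# → ⟦ χ ⟧ x K.* ⟦ ψ ⟧ x K.≈ K.1#) →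
              ∀ θ → ⟦ χ ⟧ x K.* (⟦ ψ ⟧ x K.* ⟦ θ ⟧ x) K.≈ ⟦ θ ⟧ x
  cancel-·ˡ χ ψ {x} χψ≈1 θ with x F.≟ F.0#
  ... | yes x≈0 = K.trans (K.*-congʳ (⟦≈0⟧ χ x≈0)) (K.trans (KR.zeroˡ _) (K.sym (⟦≈0⟧ θ x≈0)))
  ... | no x≉0  = K.trans (K.sym (K.*-assoc _ _ _)) (K.trans (K.*-congʳ (χψ≈1 x≉0)) (K.*-identityˡ _))

  translation : Character → Inverse characters characters
  translation χ = record
    { to        = χ ·_
    ; from      = χ ⁻¹ ·_
    ; to-cong   = λ θ≈ψ x → K.*-congˡ (θ≈ψ x)
    ; from-cong = λ θ≈ψ x → K.*-congˡ (θ≈ψ x)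
    ; inverse   = (λ {θ} ψ≈ x → K.trans (K.*-congˡ (ψ≈ x)) (cancel-·ˡ χ (χ ⁻¹) (⁻¹-inverseʳ χ) θ))
                , (λ {θ} ψ≈ x → K.trans (K.*-congˡ (ψ≈ x)) (cancel-·ˡ (χ ⁻¹) χ (⁻¹-inverseˡ χ) θ))
    }

  scaling : ∀ {s} → ¬ s F.≈ F.0# → Inverse F.setoid F.setoid
  scaling {s} s≉0 = record
    { to        = F._* s
    ; from      = F._÷ s
    ; to-cong   = F.*-congʳ
    ; from-cong = F.*-congʳ
    ; inverse   = (λ eq → F.trans (F.*-congʳ eq) (cancel (F.trans (F.*-comm _ _) (F.recip-inverse s≉0))))
                , (λ eq → F.trans (F.*-congʳ eq) (cancel (F.recip-inverse s≉0)))
    }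
    where
    cancel : ∀ {u v w} → v F.* w F.≈ F.1# → u F.* v F.* w F.≈ u
    cancel vw≈1 = F.trans (F.*-assoc _ _ _) (F.trans (F.*-congˡ vw≈1) (F.*-identityʳ _))

  cx≈x∧c≉1⇒x≈0 : ∀ {d x} → d K.* x K.≈ x → ¬ d K.≈ K.1# → x K.≈ K.0#
  cx≈x∧c≉1⇒x≈0 {d} {x} dx≈x d≉1 =
    xy≈0∧y≉0⇒x≈0 x[d-1]≈0 (λ d-1≈0 → d≉1 (KRP.x∙y⁻¹≈ε⇒x≈y d K.1# d-1≈0))
    where
    x[d-1]≈0 : x K.* (d K.- K.1#) K.≈ K.0#
    x[d-1]≈0 = begin
      x K.* (d K.- K.1#)       ≈⟨ KRP.x[y-z]≈xy-xz x d K.1# ⟩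
      x K.* d K.- x K.* K.1#   ≈⟨ K.+-cong (K.trans (K.*-comm _ _) dx≈x) (K.-‿cong (K.*-identityʳ x)) ⟩
      x K.- x                  ≈⟨ K.-‿inverseʳ x ⟩
      K.0#                     ∎

  -- Scaling the summation variable by a nonzero `x` shows that multiplication by χ(x) fixes the
  -- sum. A nonzero sum would therefore force χ(x) = 1 for all such `x`, that is, `χ` trivial.
  ∑-character : ∀ {χ} → ¬ (∀ x → ⟦ χ ⟧ x K.≈ ⟦ ε ⟧ x) → ∑ F.elements ⟦ χ ⟧ K.≈ K.0#
  ∑-character {χ} χ≉ε = ≈-stable λ ∑χ≉0 → χ≉ε (χ≈ε ∑χ≉0)
    where
    absorb : ∀ {x} → ¬ x F.≈ F.0# → ⟦ χ ⟧ x K.* ∑ F.elements ⟦ χ ⟧ K.≈ ∑ F.elements ⟦ χ ⟧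
    absorb {x} x≉0 = begin
      ⟦ χ ⟧ x K.* ∑ F.elements ⟦ χ ⟧               ≈⟨ ∑-distribˡ F.elements _ _ ⟩
      ∑ F.elements (λ u → ⟦ χ ⟧ x K.* ⟦ χ ⟧ u)     ≈⟨ ∑-cong F.elements (λ u → K.trans (K.*-comm _ _) (K.sym (homo χ u x))) ⟩
      ∑ F.elements (λ u → ⟦ χ ⟧ (u F.* x))         ≈⟨ ∑-reindex F.elements ⟦ χ ⟧ (⟦⟧-cong χ) (scaling x≉0) ⟨
      ∑ F.elements ⟦ χ ⟧                           ∎

    χ≈ε : ¬ ∑ F.elements ⟦ χ ⟧ K.≈ K.0# → ∀ x → ⟦ χ ⟧ x K.≈ ⟦ ε ⟧ x
    χ≈ε ∑χ≉0 x with x F.≟ F.0#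
    ... | yes x≈0 = ⟦≈0⟧ χ x≈0
    ... | no x≉0  = ≈-stable λ χx≉1 → ∑χ≉0 (cx≈x∧c≉1⇒x≈0 (absorb x≉0) χx≉1)

  -- Adding `δ`, the indicator of zero, completes `ε` to the constant one, whose sum is q; `δ`
  -- itself contributes 1.
  ∑ε : ∑ F.elements ⟦ ε ⟧ K.≈ (F.q ℕ.∸ 1) K.× K.1#
  ∑ε = KRP.+-cancelˡ K.1# _ _ (begin
      K.1# K.+ ∑ F.elements ⟦ ε ⟧                                  ≈⟨ K.+-congʳ ∑δ≈1 ⟨
      ∑ F.elements δ K.+ ∑ F.elements ⟦ ε ⟧                        ≈⟨ ∑-+ F.elements δ ⟦ ε ⟧ ⟨
      ∑ F.elements (λ x → K.1# K.- ⟦ ε ⟧ x K.+ ⟦ ε ⟧ x)            ≈⟨ ∑-cong F.elements (λ x →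
          K.trans (K.+-assoc _ _ _) (K.trans (K.+-congˡ (K.-‿inverseˡ _)) (K.+-identityʳ _))) ⟩
      ∑ F.elements (λ _ → K.1#)                                    ≈⟨ ∑-const F.elements K.1# ⟩
      F.q K.× K.1#                                                 ≡⟨ ≡.cong (K._× K.1#) (ℕ.m+[n∸m]≡n {1} (ℕ.<⇒≤ F.1<q)) ⟨
      K.1# K.+ (F.q ℕ.∸ 1) K.× K.1#                                ∎)
    where
    δ : F.Carrier → K.Carrier
    δ x = K.1# K.- ⟦ ε ⟧ x
    ∑δ≈1 : ∑ F.elements δ K.≈ K.1#
    ∑δ≈1 = begin
      ∑ F.elements δ     ≈⟨ ∑-single F.elements δ (λ x≈y → K.+-congˡ (K.-‿cong (⟦⟧-cong ε x≈y))) F.0#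
                              (λ y y≉0 → K.trans (K.+-congˡ (K.-‿cong (ε-nonzero y≉0))) (K.-‿inverseʳ _)) ⟩
      δ F.0#             ≈⟨ K.+-congˡ (K.trans (K.-‿cong (⟦0⟧ ε)) KRP.-0#≈0#) ⟩
      K.1# K.+ K.0#      ≈⟨ K.+-identityʳ K.1# ⟩
      K.1#               ∎

  module _ {N} (Θ : Enumeration characters N) where

    -- By orthogonality this is the indicator of 1, as `average-≈1` and `average-≉1` establish.
    average : F.Carrier → K.Carrier
    average x = 1/[q-1] K.* ∑ Θ (λ θ → ⟦ θ ⟧ x)

    private
      S : F.Carrier → K.Carrier
      S x = ∑ Θ (λ θ → ⟦ θ ⟧ x)

      S-cong : ∀ {x y} → x F.≈ y → S x K.≈ S y
      S-cong x≈y = ∑-cong Θ λ θ → ⟦⟧-cong θ x≈y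

      S-nontrivial : ∀ {x} → ∃[ χ ] ¬ ⟦ χ ⟧ x K.≈ K.1# → S x K.≈ K.0#
      S-nontrivial {x} (χ , χx≉1) = cx≈x∧c≉1⇒x≈0 (begin
        ⟦ χ ⟧ x K.* S x                    ≈⟨ ∑-distribˡ Θ _ _ ⟩
        ∑ Θ (λ θ → ⟦ χ · θ ⟧ x)            ≈⟨ ∑-reindex Θ (λ θ → ⟦ θ ⟧ x) (λ θ≈ψ → θ≈ψ x) (translation χ) ⟨
        S x                                ∎) χx≉1

      S-≉1 : ∀ {x} → ¬ x F.≈ F.1# → S x K.≈ K.0#
      S-≉1 {x} x≉1 with x F.≟ F.0#
      ... | yes x≈0 = ∑-zero Θ (λ θ → ⟦≈0⟧ θ x≈0)
      -- A separating character is available only under double negation, which the stable goal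
      -- tolerates.
      ... | no x≉0  = ≈-stable (¬¬-map S-nontrivial (separation x≉0 x≉1))

      -- The number of characters is found by double counting: in the sum of θ(x) over all pairs,
      -- summing over `θ` first leaves only x = 1, and summing over `x` first leaves only θ = ε.
      S-1 : S F.1# K.≈ (F.q ℕ.∸ 1) K.× K.1#
      S-1 = begin
        S F.1#                          ≈⟨ ∑-single F.elements S S-cong F.1# (λ _ → S-≉1) ⟨
        ∑ F.elements S                  ≈⟨ ∑-swap F.elements Θ (λ x θ → ⟦ θ ⟧ x) ⟩
        ∑ Θ (λ θ → ∑ F.elements ⟦ θ ⟧)  ≈⟨ ∑-single Θ (λ θ → ∑ F.elements ⟦ θ ⟧) (∑-cong F.elements) ε
                                             (λ θ → ∑-character {θ}) ⟩
        ∑ F.elements ⟦ ε ⟧              ≈⟨ ∑ε ⟩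
        (F.q ℕ.∸ 1) K.× K.1#            ∎

    average-cong : ∀ {x y} → x F.≈ y → average x K.≈ average y
    average-cong x≈y = K.*-congˡ (S-cong x≈y)

    average-≈1 : ∀ {x} → x F.≈ F.1# → average x K.≈ K.1#
    average-≈1 x≈1 = K.trans (K.*-congˡ (K.trans (S-cong x≈1) S-1)) (K.1/-inverse (F.q ℕ.∸ 1) {{F.q-1-nonZero}})

    average-≉1 : ∀ {x} → ¬ x F.≈ F.1# → average x K.≈ K.0#
    average-≉1 x≉1 = K.trans (K.*-congˡ (S-≉1 x≉1)) (KR.zeroʳ _)

-- The average over `θ` of the parametrised integrals.

module CharacterAverage (𝔽 : FiniteField c ℓ₁ ℓ₂) (𝕂 : ValueField k ℓ₃ ℓ₄) where

  open Appell 𝔽 𝕂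
  open Character using (⟦⟧-cong; homo; ε-homo)
  open EnumerationSums 𝕂
  open CharacterProperties 𝔽 𝕂
  private
    module FR = CommutativeRing F.commutativeRing
    module KR = CommutativeRing K.commutativeRing
    module KP = CommutativeSemigroupProperties K.*-commutativeSemigroup
    module FRP = RingProperties FR.ring
    module KRP = RingProperties KR.ring
  open CommutativeMonoidSolver KR.*-commutativeMonoid using (solve; _⊕_; _⊜_)
  private
    module FS = CommutativeMonoidSolver FR.*-commutativeMonoid

  recip-involutive : ∀ {x} → ¬ x F.≈ F.0# → F.recip (F.recip x) F.≈ x
  recip-involutive x≉0 = F.recip-unique (F.trans (F.*-comm _ _) (F.recip-inverse x≉0))

  x≈yz⇒x÷z≈y : ∀ {x y z} → ¬ z F.≈ F.0# → x F.≈ y F.* z → x F.÷ z F.≈ y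
  x≈yz⇒x÷z≈y {x} {y} {z} z≉0 x≈yz = begin
      x F.÷ z                   ≈⟨ F.*-congʳ x≈yz ⟩
      y F.* z F.* F.recip z     ≈⟨ F.*-assoc _ _ _ ⟩
      y F.* (z F.* F.recip z)   ≈⟨ F.*-congˡ (F.recip-inverse z≉0) ⟩
      y F.* F.1#                ≈⟨ F.*-identityʳ y ⟩
      y                         ∎
    where open ≈-Reasoning F.setoid

  x÷z*z≈x : ∀ {x z} → ¬ z F.≈ F.0# → x F.÷ z F.* z F.≈ x
  x÷z*z≈x {x} {z} z≉0 = F.trans (F.*-assoc _ _ _)
    (F.trans (F.*-congˡ (F.trans (F.*-comm _ _) (F.recip-inverse z≉0))) (F.*-identityʳ x))

  y+x-y≈x : ∀ x y → y F.+ (x F.- y) F.≈ x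
  y+x-y≈x x y = F.trans (F.sym (F.+-assoc _ _ _)) (FRP.xyx⁻¹≈y y x)

  -1*-1≈1 : -1ᶠ F.* -1ᶠ F.≈ F.1#
  -1*-1≈1 = F.trans (FRP.-1*x≈-x -1ᶠ) (FRP.-‿involutive F.1#)

  module _ (u t : F.Carrier) where
    private
      z = F.1# F.- u
      d = F.1# F.- u F.* (F.1# F.- t)
      open ≈-Reasoning F.setoid

    -- The point at which all occurrences of `θ` are collected. Since `F.recip` sends zero to zero,
    -- it is 0 when `w` or `u` is 1.
    argument : F.Carrier → F.Carrier
    argument w = w F.÷ (F.1# F.- w) F.* (u F.÷ z) F.* t

    argument-cong : ∀ {w w′} → w F.≈ w′ → argument w F.≈ argument w′
    argument-cong w≈w′ = F.*-congʳ (F.*-congʳ (F.*-cong w≈w′ (F.recip-cong (F.+-congˡ (F.-‿cong w≈w′)))))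

    -- The left side suits the later substitution u ↦ u(1 - t), the right side the solution of
    -- `argument w ≈ 1` for `w`.
    denominator : d F.≈ z F.+ u F.* t
    denominator = begin
      F.1# F.- u F.* (F.1# F.- t)              ≈⟨ F.+-congˡ (F.-‿cong (FRP.x[y-z]≈xy-xz u F.1# t)) ⟩
      F.1# F.- (u F.* F.1# F.- u F.* t)        ≈⟨ F.+-congˡ (F.-‿cong (F.+-congʳ (F.*-identityʳ u))) ⟩
      F.1# F.- (u F.- u F.* t)                 ≈⟨ F.+-congˡ (FRP.⁻¹-anti-homo-// u (u F.* t)) ⟩
      F.1# F.+ (u F.* t F.- u)                 ≈⟨ F.+-congˡ (F.+-comm _ _) ⟩
      F.1# F.+ (F.- u F.+ u F.* t)             ≈⟨ F.+-assoc _ _ _ ⟨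
      z F.+ u F.* t                            ∎

    private
      split : ∀ w → w F.* z F.+ (F.1# F.- w) F.* z F.≈ z
      split w = F.trans (F.sym (F.distribʳ z w (F.1# F.- w)))
        (F.trans (F.*-congʳ (y+x-y≈x F.1# w)) (F.*-identityˡ z))

      wd : ∀ w → w F.* d F.≈ w F.* z F.+ w F.* (u F.* t)
      wd w = F.trans (F.*-congˡ denominator) (F.distribˡ w z (u F.* t))

      argument≈ : ∀ w → argument w F.≈ w F.* (u F.* t) F.÷ ((F.1# F.- w) F.* z)
      argument≈ w = F.trans
        (FS.solve 5 (λ w r u s t → ((w FS.⊕ r) FS.⊕ (u FS.⊕ s)) FS.⊕ t FS.⊜ (w FS.⊕ (u FS.⊕ t)) FS.⊕ (r FS.⊕ s))
          F.refl w (F.recip (F.1# F.- w)) u (F.recip z) t)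
        (F.*-congˡ (F.sym (F.recip-* _ _)))

    -- Without denominators the equation reads w(ut) = (1 - w)z; adding wz to both sides gives wd =
    -- z.
    argument≈1⇒ : ¬ z F.≈ F.0# → ∀ {w} → argument w F.≈ F.1# → w F.* d F.≈ z
    argument≈1⇒ z≉0 {w} arg≈1 = begin
        w F.* d                              ≈⟨ wd w ⟩
        w F.* z F.+ w F.* (u F.* t)          ≈⟨ F.+-congˡ wr≈w′z ⟩
        w F.* z F.+ (F.1# F.- w) F.* z       ≈⟨ split w ⟩
        z                                    ∎
      where
      w′≉0 : ¬ F.1# F.- w F.≈ F.0#
      w′≉0 w′≈0 = F.1≉0 (F.trans (F.sym arg≈1) (F.trans (F.*-congʳ (F.*-congʳ (F.*-congˡ (F.recip-zero w′≈0))))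
        (F.trans (F.*-congʳ (F.trans (F.*-congʳ (FR.zeroʳ w)) (FR.zeroˡ _))) (FR.zeroˡ t))))
      wr≈w′z : w F.* (u F.* t) F.≈ (F.1# F.- w) F.* z
      wr≈w′z = begin
        w F.* (u F.* t)                                                  ≈⟨ x÷z*z≈x (F.x≉0∧y≉0⇒xy≉0 w′≉0 z≉0) ⟨
        w F.* (u F.* t) F.÷ ((F.1# F.- w) F.* z) F.* ((F.1# F.- w) F.* z) ≈⟨ F.*-congʳ (F.trans (F.sym (argument≈ w)) arg≈1) ⟩
        F.1# F.* ((F.1# F.- w) F.* z)                                    ≈⟨ F.*-identityˡ _ ⟩
        (F.1# F.- w) F.* z                                               ∎

    argument≈1⇐ : ¬ z F.≈ F.0# → ¬ u F.* t F.≈ F.0# → ∀ {w} → w F.* d F.≈ z → argument w F.≈ F.1#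
    argument≈1⇐ z≉0 r≉0 {w} wd≈z =
        F.trans (argument≈ w) (x≈yz⇒x÷z≈y (F.x≉0∧y≉0⇒xy≉0 w′≉0 z≉0) (F.trans wr≈w′z (F.sym (F.*-identityˡ _))))
      where
      wr≈w′z : w F.* (u F.* t) F.≈ (F.1# F.- w) F.* z
      wr≈w′z = FRP.+-cancelˡ (w F.* z) _ _ (F.trans (F.sym (wd w)) (F.trans wd≈z (F.sym (split w))))
      w′≉0 : ¬ F.1# F.- w F.≈ F.0#
      -- For w = 1 the cleared equation would leave ut = 0.
      w′≉0 w′≈0 = r≉0 (begin
        u F.* t                  ≈⟨ F.*-identityˡ _ ⟨
        F.1# F.* (u F.* t)       ≈⟨ F.*-congʳ (FRP.x∙y⁻¹≈ε⇒x≈y F.1# w w′≈0) ⟩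
        w F.* (u F.* t)          ≈⟨ wr≈w′z ⟩
        (F.1# F.- w) F.* z       ≈⟨ F.*-congʳ w′≈0 ⟩
        F.0# F.* z               ≈⟨ FR.zeroˡ z ⟩
        F.0#                     ∎)

  open ≈-Reasoning K.setoid

  ·-·⁻¹-inverse : ∀ B C {x} → ¬ x F.≈ F.0# → ⟦ B ⁻¹ · C ⟧ x K.* ⟦ B · C ⁻¹ ⟧ x K.≈ K.1#
  ·-·⁻¹-inverse B C {x} x≉0 = K.trans (KP.interchange _ _ _ _)
    (K.trans (K.*-cong (⁻¹-inverseˡ B x≉0) (⁻¹-inverseʳ C x≉0)) (K.*-identityˡ _))

  ε-÷ : ∀ x {z} → ¬ z F.≈ F.0# → ⟦ ε ⟧ (x F.÷ z) K.≈ ⟦ ε ⟧ x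
  ε-÷ x {z} z≉0 = K.trans (K.sym (K.*-identityʳ _)) (K.trans (K.*-congˡ (K.sym (ε-nonzero z≉0)))
    (K.trans (K.sym (homo ε (x F.÷ z) z)) (⟦⟧-cong ε (x÷z*z≈x z≉0))))

  ·⁻¹-recip : ∀ B C {x} → ¬ x F.≈ F.0# → ⟦ B · C ⁻¹ ⟧ (F.recip x) K.≈ ⟦ B ⁻¹ · C ⟧ x
  ·⁻¹-recip B C x≉0 = K.*-congˡ (⟦⟧-cong C (recip-involutive x≉0))

  -- The complement of ε(1 - u) to one is the indicator of u = 1, so it picks out the missing term.
  omit-1 : ∀ f → (∀ {x y} → x F.≈ y → f x K.≈ f y) →
           ∑ F.elements (λ u → f u K.* ⟦ ε ⟧ (F.1# F.- u)) K.≈ ∑ F.elements f K.- f F.1#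
  omit-1 f f-cong = KRP.x≈z//y _ _ _ (begin
      ∑ F.elements (λ u → f u K.* ε′ u) K.+ f F.1#
        ≈⟨ K.+-congˡ single ⟨
      ∑ F.elements (λ u → f u K.* ε′ u) K.+ ∑ F.elements (λ u → f u K.* (K.1# K.- ε′ u))
        ≈⟨ ∑-+ F.elements _ _ ⟨
      ∑ F.elements (λ u → f u K.* ε′ u K.+ f u K.* (K.1# K.- ε′ u))
        ≈⟨ ∑-cong F.elements (λ u → K.trans (K.sym (K.distribˡ (f u) (ε′ u) (K.1# K.- ε′ u)))
             (K.trans (K.*-congˡ (K.trans (K.sym (K.+-assoc _ _ _)) (KRP.xyx⁻¹≈y (ε′ u) K.1#))) (K.*-identityʳ (f u)))) ⟩
      ∑ F.elements f ∎)
    where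
    ε′ : F.Carrier → K.Carrier
    ε′ u = ⟦ ε ⟧ (F.1# F.- u)
    ε′-cong : ∀ {x y} → x F.≈ y → ε′ x K.≈ ε′ y
    ε′-cong x≈y = ⟦⟧-cong ε (F.+-congˡ (F.-‿cong x≈y))
    single : ∑ F.elements (λ u → f u K.* (K.1# K.- ε′ u)) K.≈ f F.1#
    single = begin
      ∑ F.elements (λ u → f u K.* (K.1# K.- ε′ u))
        ≈⟨ ∑-single F.elements _ (λ x≈y → K.*-cong (f-cong x≈y) (K.+-congˡ (K.-‿cong (ε′-cong x≈y)))) F.1#
             (λ u u≉1 → K.trans (K.*-congˡ (K.trans (K.+-congˡ (K.-‿cong (ε-nonzero (x≉y⇒x-y≉0 (λ 1≈u → u≉1 (F.sym 1≈u))))))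
               (K.-‿inverseʳ _))) (KR.zeroʳ _)) ⟩
      f F.1# K.* (K.1# K.- ε′ F.1#)
        ≈⟨ K.*-congˡ (K.trans (K.+-congˡ (K.trans (K.-‿cong (⟦≈0⟧ ε (F.-‿inverseʳ _))) KRP.-0#≈0#)) (K.+-identityʳ _)) ⟩
      f F.1# K.* K.1#
        ≈⟨ K.*-identityʳ _ ⟩
      f F.1# ∎

  -- The outer integral of the Appell series, with the inner one abstracted to `h`, which is
  -- unaffected when `B` is replaced by `B · θ`.
  B-integral : (B C : Character) (h : F.Carrier → K.Carrier) → K.Carrier
  B-integral B C h = ∑ F.elements λ u → ⟦ B ⟧ u K.* ⟦ B ⁻¹ · C ⟧ (F.1# F.- u) K.* h u

  opaque
    unfolding ∑

    binom≡ : ∀ A B → binom A B ≡ ⟦ B ⟧ -1ᶠ K.* ∑ F.elements (λ w → ⟦ A ⟧ w K.* ⟦ B ⁻¹ ⟧ (F.1# F.- w))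
    binom≡ A B = ≡.refl

  module _ {N} (Θ : Enumeration characters N) (B C : Character) (t : F.Carrier) where

    -- Only w = z/d survives the average. There `B · C ⁻¹` contributes its value at `z`, which
    -- cancels the weight `B ⁻¹ · C` at `z`, times the value of `B ⁻¹ · C` at `d`. The factor ε(z)
    -- keeps the omission of u = 1 visible.
    inner-sum : ∀ u →
      ∑ F.elements (λ w → ⟦ B ⟧ u K.* ⟦ B ⁻¹ · C ⟧ (F.1# F.- u) K.* (⟦ B · C ⁻¹ ⟧ w K.* average Θ (argument u t w)))
        K.≈
      ⟦ ε ⟧ t K.* (⟦ B ⟧ u K.* ⟦ B ⁻¹ · C ⟧ (F.1# F.- u F.* (F.1# F.- t)) K.* ⟦ ε ⟧ (F.1# F.- u))
    inner-sum u = by-cases (t F.≟ F.0#) (u F.≟ F.0#) (z F.≟ F.0#) (d F.≟ F.0#)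
      where
      z = F.1# F.- u
      d = F.1# F.- u F.* (F.1# F.- t)
      term : F.Carrier → K.Carrier
      term w = ⟦ B ⟧ u K.* ⟦ B ⁻¹ · C ⟧ z K.* (⟦ B · C ⁻¹ ⟧ w K.* average Θ (argument u t w))

      term-cong : ∀ {w w′} → w F.≈ w′ → term w K.≈ term w′
      term-cong w≈w′ = K.*-congˡ (K.*-cong (⟦⟧-cong (B · C ⁻¹) w≈w′) (average-cong Θ (argument-cong u t w≈w′)))

      term-zero : ∀ {w} → ¬ argument u t w F.≈ F.1# → term w K.≈ K.0#
      term-zero arg≉1 = K.trans (K.*-congˡ (K.trans (K.*-congˡ (average-≉1 Θ arg≉1)) (KR.zeroʳ _))) (KR.zeroʳ _)

      degenerate : (∀ w → argument u t w F.≈ F.0#) →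
                   ⟦ ε ⟧ t K.* (⟦ B ⟧ u K.* ⟦ B ⁻¹ · C ⟧ d K.* ⟦ ε ⟧ z) K.≈ K.0# →
                   ∑ F.elements term K.≈ ⟦ ε ⟧ t K.* (⟦ B ⟧ u K.* ⟦ B ⁻¹ · C ⟧ d K.* ⟦ ε ⟧ z)
      degenerate arg≈0 rhs≈0 = K.trans
        (∑-zero F.elements (λ w → term-zero (λ arg≈1 → F.1≉0 (F.trans (F.sym arg≈1) (arg≈0 w)))))
        (K.sym rhs≈0)

      by-cases : Dec (t F.≈ F.0#) → Dec (u F.≈ F.0#) → Dec (z F.≈ F.0#) → Dec (d F.≈ F.0#) →
                 ∑ F.elements term K.≈ ⟦ ε ⟧ t K.* (⟦ B ⟧ u K.* ⟦ B ⁻¹ · C ⟧ d K.* ⟦ ε ⟧ z)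
      -- When `t`, `u` or `z` is zero, so is the argument for every `w`, while ε(t), B(u) or ε(z)
      -- annihilates the right-hand side.
      by-cases (yes t≈0) _ _ _ = degenerate
        (λ w → F.trans (F.*-congˡ t≈0) (FR.zeroʳ _))
        (K.trans (K.*-congʳ (⟦≈0⟧ ε t≈0)) (KR.zeroˡ _))
      by-cases (no _) (yes u≈0) _ _ = degenerate
        (λ w → F.trans (F.*-congʳ (F.trans (F.*-congˡ (F.trans (F.*-congʳ u≈0) (FR.zeroˡ _))) (FR.zeroʳ _))) (FR.zeroˡ _))
        (K.trans (K.*-congˡ (K.trans (K.*-congʳ (K.trans (K.*-congʳ (⟦≈0⟧ B u≈0)) (KR.zeroˡ _))) (KR.zeroˡ _))) (KR.zeroʳ _))
      by-cases (no _) (no _) (yes z≈0) _ = degenerate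
        (λ w → F.trans (F.*-congʳ (F.trans (F.*-congˡ (F.trans (F.*-congˡ (F.recip-zero z≈0)) (FR.zeroʳ _))) (FR.zeroʳ _))) (FR.zeroˡ _))
        (K.trans (K.*-congˡ (K.trans (K.*-congˡ (⟦≈0⟧ ε z≈0)) (KR.zeroʳ _))) (KR.zeroʳ _))
      -- Now wd = z has no solution, and the value of `B ⁻¹ · C` at `d` is zero.
      by-cases (no _) (no _) (no z≉0) (yes d≈0) = K.trans
        (∑-zero F.elements (λ w → term-zero (λ arg≈1 → z≉0
          (F.trans (F.sym (argument≈1⇒ u t z≉0 arg≈1)) (F.trans (F.*-congˡ d≈0) (FR.zeroʳ w))))))
        (K.sym (K.trans (K.*-congˡ (K.trans (K.*-congʳ (K.trans (K.*-congˡ (⟦≈0⟧ (B ⁻¹ · C) d≈0)) (KR.zeroʳ _))) (KR.zeroˡ _))) (KR.zeroʳ _)))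
      by-cases (no t≉0) (no u≉0) (no z≉0) (no d≉0) = begin
        ∑ F.elements term
          ≈⟨ ∑-single F.elements term term-cong (z F.÷ d) (λ w w≉ → term-zero (λ arg≈1 →
               w≉ (F.sym (x≈yz⇒x÷z≈y d≉0 (F.sym (argument≈1⇒ u t z≉0 arg≈1)))))) ⟩
        ⟦ B ⟧ u K.* ⟦ B ⁻¹ · C ⟧ z K.* (⟦ B · C ⁻¹ ⟧ (z F.÷ d) K.* average Θ (argument u t (z F.÷ d)))
          ≈⟨ K.*-congˡ (K.*-cong (K.trans (homo (B · C ⁻¹) z (F.recip d)) (K.*-congˡ (·⁻¹-recip B C d≉0)))
               (average-≈1 Θ (argument≈1⇐ u t z≉0 (F.x≉0∧y≉0⇒xy≉0 u≉0 t≉0) (x÷z*z≈x d≉0)))) ⟩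
        ⟦ B ⟧ u K.* ⟦ B ⁻¹ · C ⟧ z K.* (⟦ B · C ⁻¹ ⟧ z K.* ⟦ B ⁻¹ · C ⟧ d K.* K.1#)
          ≈⟨ solve 5 (λ b p q r i → (b ⊕ p) ⊕ ((q ⊕ r) ⊕ i) ⊜ (p ⊕ q) ⊕ ((b ⊕ r) ⊕ i)) K.refl
               (⟦ B ⟧ u) (⟦ B ⁻¹ · C ⟧ z) (⟦ B · C ⁻¹ ⟧ z) (⟦ B ⁻¹ · C ⟧ d) K.1# ⟩
        ⟦ B ⁻¹ · C ⟧ z K.* ⟦ B · C ⁻¹ ⟧ z K.* (⟦ B ⟧ u K.* ⟦ B ⁻¹ · C ⟧ d K.* K.1#)
          ≈⟨ K.*-congʳ (·-·⁻¹-inverse B C z≉0) ⟩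
        K.1# K.* (⟦ B ⟧ u K.* ⟦ B ⁻¹ · C ⟧ d K.* K.1#)
          ≈⟨ K.*-cong (ε-nonzero t≉0) (K.*-congˡ (ε-nonzero z≉0)) ⟨
        ⟦ ε ⟧ t K.* (⟦ B ⟧ u K.* ⟦ B ⁻¹ · C ⟧ d K.* ⟦ ε ⟧ z) ∎

    -- The two factors θ(-1) cancel because (-1)² = 1. What remains of `θ`, at w, 1/(1 - w), u, 1/(1
    -- - u) and t, multiplies to its value at `argument`.
    θ-integral : ∀ h θ →
      binom (B · C ⁻¹ · θ) θ K.* (⟦ θ ⟧ -1ᶠ K.* B-integral (B · θ) C h) K.* ⟦ θ ⟧ t
        K.≈
      ∑ F.elements (λ u → ∑ F.elements (λ w →
        ⟦ B ⟧ u K.* ⟦ B ⁻¹ · C ⟧ (F.1# F.- u) K.* h u K.* ⟦ B · C ⁻¹ ⟧ w K.* ⟦ θ ⟧ (argument u t w)))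
    θ-integral h θ = begin
        binom (B · C ⁻¹ · θ) θ K.* (⟦ θ ⟧ -1ᶠ K.* ∑ F.elements U) K.* ⟦ θ ⟧ t
          ≡⟨ ≡.cong (λ b → b K.* (⟦ θ ⟧ -1ᶠ K.* ∑ F.elements U) K.* ⟦ θ ⟧ t) (binom≡ (B · C ⁻¹ · θ) θ) ⟩
        ⟦ θ ⟧ -1ᶠ K.* ∑ F.elements W K.* (⟦ θ ⟧ -1ᶠ K.* ∑ F.elements U) K.* ⟦ θ ⟧ t
          ≈⟨ solve 4 (λ m w u t → ((m ⊕ w) ⊕ (m ⊕ u)) ⊕ t ⊜ (m ⊕ m) ⊕ (u ⊕ (w ⊕ t))) K.refl
               (⟦ θ ⟧ -1ᶠ) (∑ F.elements W) (∑ F.elements U) (⟦ θ ⟧ t) ⟩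
        ⟦ θ ⟧ -1ᶠ K.* ⟦ θ ⟧ -1ᶠ K.* (∑ F.elements U K.* (∑ F.elements W K.* ⟦ θ ⟧ t))
          ≈⟨ K.trans (K.*-congʳ (K.trans (K.sym (homo θ -1ᶠ -1ᶠ)) (⟦≈1⟧ θ -1*-1≈1))) (K.*-identityˡ _) ⟩
        ∑ F.elements U K.* (∑ F.elements W K.* ⟦ θ ⟧ t)
          ≈⟨ ∑-distribʳ F.elements _ _ ⟩
        ∑ F.elements (λ u → U u K.* (∑ F.elements W K.* ⟦ θ ⟧ t))
          ≈⟨ ∑-cong F.elements (λ u → K.trans (K.*-congˡ (∑-distribʳ F.elements _ _)) (∑-distribˡ F.elements _ _)) ⟩
        ∑ F.elements (λ u → ∑ F.elements (λ w → U u K.* (W w K.* ⟦ θ ⟧ t)))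
          ≈⟨ ∑-cong F.elements (λ u → ∑-cong F.elements (λ w → pointwise u w)) ⟩
        ∑ F.elements (λ u → ∑ F.elements (λ w →
          ⟦ B ⟧ u K.* ⟦ B ⁻¹ · C ⟧ (F.1# F.- u) K.* h u K.* ⟦ B · C ⁻¹ ⟧ w K.* ⟦ θ ⟧ (argument u t w))) ∎
      where
      U W : F.Carrier → K.Carrier
      U u = ⟦ B · θ ⟧ u K.* ⟦ (B · θ) ⁻¹ · C ⟧ (F.1# F.- u) K.* h u
      W w = ⟦ B · C ⁻¹ · θ ⟧ w K.* ⟦ θ ⁻¹ ⟧ (F.1# F.- w)

      pointwise : ∀ u w → U u K.* (W w K.* ⟦ θ ⟧ t) K.≈
        ⟦ B ⟧ u K.* ⟦ B ⁻¹ · C ⟧ (F.1# F.- u) K.* h u K.* ⟦ B · C ⁻¹ ⟧ w K.* ⟦ θ ⟧ (argument u t w)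
      pointwise u w = K.trans
        (solve 10 (λ bu θu bz θz cz hu q θw θr θt →
            (((bu ⊕ θu) ⊕ ((bz ⊕ θz) ⊕ cz)) ⊕ hu) ⊕ (((q ⊕ θw) ⊕ θr) ⊕ θt)
              ⊜ (((bu ⊕ (bz ⊕ cz)) ⊕ hu) ⊕ q) ⊕ (((θw ⊕ θr) ⊕ (θu ⊕ θz)) ⊕ θt)) K.refl
          (⟦ B ⟧ u) (⟦ θ ⟧ u) (⟦ B ⁻¹ ⟧ z) (⟦ θ ⁻¹ ⟧ z) (⟦ C ⟧ z) (h u) (⟦ B · C ⁻¹ ⟧ w)
          (⟦ θ ⟧ w) (⟦ θ ⁻¹ ⟧ (F.1# F.- w)) (⟦ θ ⟧ t))
        (K.*-congˡ (K.sym (K.trans (homo θ _ t) (K.*-congʳ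
          (K.trans (homo θ _ _) (K.*-cong (homo θ _ _) (homo θ _ _)))))))
        where z = F.1# F.- u

    -- After the sums are interchanged, `inner-sum` evaluates the sum over `w` and `omit-1` accounts
    -- for ε(1 - u). At u = 1 the point 1 - u(1 - t) is `t`, whence the subtracted term.
    θ-average : ∀ h → (∀ {x y} → x F.≈ y → h x K.≈ h y) →
      1/[q-1] K.* ∑ Θ (λ θ → binom (B · C ⁻¹ · θ) θ K.* (⟦ θ ⟧ -1ᶠ K.* B-integral (B · θ) C h) K.* ⟦ θ ⟧ t)
        K.≈
      ⟦ ε ⟧ t K.*
        (∑ F.elements (λ u → ⟦ B ⟧ u K.* ⟦ B ⁻¹ · C ⟧ (F.1# F.- u F.* (F.1# F.- t)) K.* h u)
          K.- ⟦ B ⁻¹ · C ⟧ t K.* h F.1#)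
    θ-average h h-cong = begin
        1/[q-1] K.* ∑ Θ (λ θ → binom (B · C ⁻¹ · θ) θ K.* (⟦ θ ⟧ -1ᶠ K.* B-integral (B · θ) C h) K.* ⟦ θ ⟧ t)
          ≈⟨ K.*-congˡ (∑-cong Θ (θ-integral h)) ⟩
        1/[q-1] K.* ∑ Θ (λ θ → ∑ F.elements (λ u → ∑ F.elements (λ w → p u w K.* ⟦ θ ⟧ (argument u t w))))
          ≈⟨ K.*-congˡ (K.trans (∑-swap Θ F.elements _) (∑-cong F.elements (λ u → ∑-swap Θ F.elements _))) ⟩
        1/[q-1] K.* ∑ F.elements (λ u → ∑ F.elements (λ w → ∑ Θ (λ θ → p u w K.* ⟦ θ ⟧ (argument u t w))))
          ≈⟨ K.trans (∑-distribˡ F.elements _ _) (∑-cong F.elements (λ u → ∑-distribˡ F.elements _ _)) ⟩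
        ∑ F.elements (λ u → ∑ F.elements (λ w → 1/[q-1] K.* ∑ Θ (λ θ → p u w K.* ⟦ θ ⟧ (argument u t w))))
          ≈⟨ ∑-cong F.elements (λ u → ∑-cong F.elements (λ w → regroup u w)) ⟩
        ∑ F.elements (λ u → ∑ F.elements (λ w → h u K.* r u w))
          ≈⟨ ∑-cong F.elements (λ u → K.sym (∑-distribˡ F.elements (h u) (r u))) ⟩
        ∑ F.elements (λ u → h u K.* ∑ F.elements (r u))
          ≈⟨ ∑-cong F.elements (λ u → K.trans (K.*-congˡ (inner-sum u))
               (solve 5 (λ h e b x o → h ⊕ (e ⊕ ((b ⊕ x) ⊕ o)) ⊜ e ⊕ (((b ⊕ x) ⊕ h) ⊕ o)) K.refl
                 (h u) (⟦ ε ⟧ t) (⟦ B ⟧ u) (⟦ B ⁻¹ · C ⟧ (F.1# F.- u F.* (F.1# F.- t))) (⟦ ε ⟧ (F.1# F.- u)))) ⟩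
        ∑ F.elements (λ u → ⟦ ε ⟧ t K.* (f u K.* ⟦ ε ⟧ (F.1# F.- u)))
          ≈⟨ ∑-distribˡ F.elements _ _ ⟨
        ⟦ ε ⟧ t K.* ∑ F.elements (λ u → f u K.* ⟦ ε ⟧ (F.1# F.- u))
          ≈⟨ K.*-congˡ (omit-1 f f-cong) ⟩
        ⟦ ε ⟧ t K.* (∑ F.elements f K.- f F.1#)
          ≈⟨ K.*-congˡ (K.+-congˡ (K.-‿cong (K.*-congʳ (K.trans (K.*-cong (ε-homo B) (⟦⟧-cong (B ⁻¹ · C) 1-1*[1-t]≈t)) (K.*-identityˡ _))))) ⟩
        ⟦ ε ⟧ t K.* (∑ F.elements f K.- ⟦ B ⁻¹ · C ⟧ t K.* h F.1#) ∎
      where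
      p r : F.Carrier → F.Carrier → K.Carrier
      p u w = ⟦ B ⟧ u K.* ⟦ B ⁻¹ · C ⟧ (F.1# F.- u) K.* h u K.* ⟦ B · C ⁻¹ ⟧ w
      r u w = ⟦ B ⟧ u K.* ⟦ B ⁻¹ · C ⟧ (F.1# F.- u) K.* (⟦ B · C ⁻¹ ⟧ w K.* average Θ (argument u t w))

      f : F.Carrier → K.Carrier
      f u = ⟦ B ⟧ u K.* ⟦ B ⁻¹ · C ⟧ (F.1# F.- u F.* (F.1# F.- t)) K.* h u

      f-cong : ∀ {x y} → x F.≈ y → f x K.≈ f y
      f-cong x≈y = K.*-cong (K.*-cong (⟦⟧-cong B x≈y)
        (⟦⟧-cong (B ⁻¹ · C) (F.+-congˡ (F.-‿cong (F.*-congʳ x≈y))))) (h-cong x≈y)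

      1-1*[1-t]≈t : F.1# F.- F.1# F.* (F.1# F.- t) F.≈ t
      1-1*[1-t]≈t = F.trans (denominator F.1# t)
        (F.trans (F.+-cong (F.-‿inverseʳ F.1#) (F.*-identityˡ t)) (F.+-identityˡ t))

      regroup : ∀ u w → 1/[q-1] K.* ∑ Θ (λ θ → p u w K.* ⟦ θ ⟧ (argument u t w)) K.≈ h u K.* r u w
      regroup u w = K.trans (K.*-congˡ (K.sym (∑-distribˡ Θ _ _)))
        (solve 6 (λ i b x h q s → i ⊕ ((((b ⊕ x) ⊕ h) ⊕ q) ⊕ s) ⊜ h ⊕ ((b ⊕ x) ⊕ (q ⊕ (i ⊕ s)))) K.refl
          1/[q-1] (⟦ B ⟧ u) (⟦ B ⁻¹ · C ⟧ (F.1# F.- u)) (h u) (⟦ B · C ⁻¹ ⟧ w) (∑ Θ (λ θ → ⟦ θ ⟧ (argument u t w))))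

-- From integrals back to Appell series and the generating functions.

module GeneratingFunction (𝔽 : FiniteField c ℓ₁ ℓ₂) (𝕂 : ValueField k ℓ₃ ℓ₄) where

  open Appell 𝔽 𝕂
  open Character using (⟦⟧-cong; homo)
  open EnumerationSums 𝕂
  open CharacterProperties 𝔽 𝕂
  open CharacterAverage 𝔽 𝕂
  private
    module FR = CommutativeRing F.commutativeRing
    module KR = CommutativeRing K.commutativeRing
    module FRP = RingProperties FR.ring
    module KRP = RingProperties KR.ring
  open CommutativeMonoidSolver KR.*-commutativeMonoid using (solve; _⊕_; _⊜_)
  open ≈-Reasoning K.setoid

  inner-integral : (A B′ C′ : Character) (x y u : F.Carrier) → K.Carrier
  inner-integral A B′ C′ x y u = ∑ F.elements λ v →
    ⟦ B′ ⟧ v K.* ⟦ B′ ⁻¹ · C′ ⟧ (F.1# F.- v) K.* ⟦ A ⁻¹ ⟧ (F.1# F.- u F.* x F.- v F.* y)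

  -- `u` and `x` enter only through their product, so a rescaling of `u` can be undone by one of
  -- `x`.
  inner-integral-cong : ∀ A B′ C′ {x x′ y u u′} → u F.* x F.≈ u′ F.* x′ →
                        inner-integral A B′ C′ x y u K.≈ inner-integral A B′ C′ x′ y u′
  inner-integral-cong A B′ C′ ux≈u′x′ = ∑-cong F.elements λ v →
    K.*-congˡ (⟦⟧-cong (A ⁻¹) (F.+-congʳ (F.+-congˡ (F.-‿cong ux≈u′x′))))

  opaque
    unfolding ∑

    F₂≡ : ∀ A B B′ C C′ x y → F₂ A B B′ C C′ x y ≡
      ⟦ ε ⟧ (x F.* y) K.* ⟦ B · B′ · C · C′ ⟧ -1ᶠ K.*
      ∑ F.elements (λ u → ∑ F.elements (λ v →
        ⟦ B ⟧ u K.* ⟦ B′ ⟧ v K.*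
        ⟦ B ⁻¹ · C ⟧ (F.1# F.- u) K.* ⟦ B′ ⁻¹ · C′ ⟧ (F.1# F.- v) K.*
        ⟦ A ⁻¹ ⟧ (F.1# F.- u F.* x F.- v F.* y)))
    F₂≡ A B B′ C C′ x y = ≡.refl

    ₂F₁≡ : ∀ A B C x → ₂F₁ A B C x ≡
      ⟦ ε ⟧ x K.* ⟦ B · C ⟧ -1ᶠ K.*
      ∑ F.elements (λ u → ⟦ B ⟧ u K.* ⟦ B ⁻¹ · C ⟧ (F.1# F.- u) K.* ⟦ A ⁻¹ ⟧ (F.1# F.- x F.* u))
    ₂F₁≡ A B C x = ≡.refl

  F₂≈B-integral : ∀ A B B′ C C′ x y → F₂ A B B′ C C′ x y K.≈
    ⟦ ε ⟧ (x F.* y) K.* ⟦ B · B′ · C · C′ ⟧ -1ᶠ K.* B-integral B C (inner-integral A B′ C′ x y)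
  F₂≈B-integral A B B′ C C′ x y = K.trans (K.reflexive (F₂≡ A B B′ C C′ x y))
    (K.*-congˡ (∑-cong F.elements λ u → K.trans
      (∑-cong F.elements λ v → solve 5 (λ b b′ c c′ a → (((b ⊕ b′) ⊕ c) ⊕ c′) ⊕ a ⊜ (b ⊕ c) ⊕ ((b′ ⊕ c′) ⊕ a)) K.refl
        (⟦ B ⟧ u) (⟦ B′ ⟧ v) (⟦ B ⁻¹ · C ⟧ (F.1# F.- u)) (⟦ B′ ⁻¹ · C′ ⟧ (F.1# F.- v))
        (⟦ A ⁻¹ ⟧ (F.1# F.- u F.* x F.- v F.* y)))
      (K.sym (∑-distribˡ F.elements _ _))))

  -- Exchanging the two integrations gives the symmetry that carries the formula in `x` to the one
  -- in `y`.
  F₂-swap : ∀ A B B′ C C′ x y → F₂ A B B′ C C′ x y K.≈ F₂ A B′ B C′ C y x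
  F₂-swap A B B′ C C′ x y = begin
      F₂ A B B′ C C′ x y
        ≡⟨ F₂≡ A B B′ C C′ x y ⟩
      ⟦ ε ⟧ (x F.* y) K.* ⟦ B · B′ · C · C′ ⟧ -1ᶠ K.* ∑ F.elements (λ u → ∑ F.elements (λ v → f u v))
        ≈⟨ K.*-cong
             (K.*-cong (⟦⟧-cong ε (F.*-comm x y))
               (solve 4 (λ b b′ c c′ → ((b ⊕ b′) ⊕ c) ⊕ c′ ⊜ ((b′ ⊕ b) ⊕ c′) ⊕ c) K.refl
                 (⟦ B ⟧ -1ᶠ) (⟦ B′ ⟧ -1ᶠ) (⟦ C ⟧ -1ᶠ) (⟦ C′ ⟧ -1ᶠ)))
             (K.trans (∑-swap F.elements F.elements f)
               (∑-cong F.elements λ v → ∑-cong F.elements λ u → swapped u v)) ⟩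
      ⟦ ε ⟧ (y F.* x) K.* ⟦ B′ · B · C′ · C ⟧ -1ᶠ K.* ∑ F.elements (λ v → ∑ F.elements (λ u → g v u))
        ≡⟨ F₂≡ A B′ B C′ C y x ⟨
      F₂ A B′ B C′ C y x ∎
    where
    f g : F.Carrier → F.Carrier → K.Carrier
    f u v = ⟦ B ⟧ u K.* ⟦ B′ ⟧ v K.* ⟦ B ⁻¹ · C ⟧ (F.1# F.- u) K.* ⟦ B′ ⁻¹ · C′ ⟧ (F.1# F.- v) K.*
            ⟦ A ⁻¹ ⟧ (F.1# F.- u F.* x F.- v F.* y)
    g v u = ⟦ B′ ⟧ v K.* ⟦ B ⟧ u K.* ⟦ B′ ⁻¹ · C′ ⟧ (F.1# F.- v) K.* ⟦ B ⁻¹ · C ⟧ (F.1# F.- u) K.*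
            ⟦ A ⁻¹ ⟧ (F.1# F.- v F.* y F.- u F.* x)
    swapped : ∀ u v → f u v K.≈ g v u
    swapped u v = K.*-cong
      (solve 4 (λ b b′ c c′ → ((b ⊕ b′) ⊕ c) ⊕ c′ ⊜ ((b′ ⊕ b) ⊕ c′) ⊕ c) K.refl
        (⟦ B ⟧ u) (⟦ B′ ⟧ v) (⟦ B ⁻¹ · C ⟧ (F.1# F.- u)) (⟦ B′ ⁻¹ · C′ ⟧ (F.1# F.- v)))
      (⟦⟧-cong (A ⁻¹) (F.trans (F.+-assoc _ _ _) (F.trans (F.+-congˡ (F.+-comm _ _)) (F.sym (F.+-assoc _ _ _)))))

  -- The substitution u ↦ u(1 - t), with s = 1 - t.
  B-integral-rescale : ∀ A B C B′ C′ x y {s} → ¬ s F.≈ F.0# →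
    ∑ F.elements (λ u → ⟦ B ⟧ u K.* ⟦ B ⁻¹ · C ⟧ (F.1# F.- u F.* s) K.* inner-integral A B′ C′ x y u)
      K.≈ ⟦ B ⁻¹ ⟧ s K.* B-integral B C (inner-integral A B′ C′ (x F.÷ s) y)
  B-integral-rescale A B C B′ C′ x y {s} s≉0 = begin
      ∑ F.elements (λ u → ⟦ B ⟧ u K.* X u K.* h u)
        ≈⟨ ∑-cong F.elements pointwise ⟩
      ∑ F.elements (λ u → ⟦ B ⁻¹ ⟧ s K.* g (u F.* s))
        ≈⟨ ∑-distribˡ F.elements _ _ ⟨
      ⟦ B ⁻¹ ⟧ s K.* ∑ F.elements (λ u → g (u F.* s))
        ≈⟨ K.*-congˡ (∑-reindex F.elements g g-cong (scaling s≉0)) ⟨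
      ⟦ B ⁻¹ ⟧ s K.* ∑ F.elements g ∎
    where
    X h h′ g : F.Carrier → K.Carrier
    X u = ⟦ B ⁻¹ · C ⟧ (F.1# F.- u F.* s)
    h = inner-integral A B′ C′ x y
    h′ = inner-integral A B′ C′ (x F.÷ s) y
    g u = ⟦ B ⟧ u K.* ⟦ B ⁻¹ · C ⟧ (F.1# F.- u) K.* h′ u

    g-cong : ∀ {u v} → u F.≈ v → g u K.≈ g v
    g-cong u≈v = K.*-cong (K.*-cong (⟦⟧-cong B u≈v) (⟦⟧-cong (B ⁻¹ · C) (F.+-congˡ (F.-‿cong u≈v))))
      (inner-integral-cong A B′ C′ (F.*-congʳ u≈v))

    ux≈us[x÷s] : ∀ u → u F.* x F.≈ u F.* s F.* (x F.÷ s)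
    ux≈us[x÷s] u = F.sym (F.trans (F.*-assoc _ _ _) (F.*-congˡ
      (F.trans (F.*-comm _ _) (x÷z*z≈x s≉0))))

    pointwise : ∀ u → ⟦ B ⟧ u K.* X u K.* h u K.≈ ⟦ B ⁻¹ ⟧ s K.* g (u F.* s)
    pointwise u = begin
      ⟦ B ⟧ u K.* X u K.* h u
        ≈⟨ K.*-identityˡ _ ⟨
      -- The 1 is split as B⁻¹(s)B(s): the factor B(s) completes B(u) to B(us), and B⁻¹(s) stays in
      -- front.
      K.1# K.* (⟦ B ⟧ u K.* X u K.* h u)
        ≈⟨ K.*-cong (K.sym (⁻¹-inverseˡ B s≉0)) (K.*-congˡ (inner-integral-cong A B′ C′ (ux≈us[x÷s] u))) ⟩
      ⟦ B ⁻¹ ⟧ s K.* ⟦ B ⟧ s K.* (⟦ B ⟧ u K.* X u K.* h′ (u F.* s))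
        ≈⟨ solve 5 (λ i s u x h → (i ⊕ s) ⊕ ((u ⊕ x) ⊕ h) ⊜ i ⊕ (((u ⊕ s) ⊕ x) ⊕ h)) K.refl
             (⟦ B ⁻¹ ⟧ s) (⟦ B ⟧ s) (⟦ B ⟧ u) (X u) (h′ (u F.* s)) ⟩
      ⟦ B ⁻¹ ⟧ s K.* (⟦ B ⟧ u K.* ⟦ B ⟧ s K.* X u K.* h′ (u F.* s))
        ≈⟨ K.*-congˡ (K.*-congʳ (K.*-congʳ (K.sym (homo B u s)))) ⟩
      ⟦ B ⁻¹ ⟧ s K.* g (u F.* s) ∎

  -- At u = 1 the last argument factors as 1 - x - vy = (1 - x)(1 - vy/(1 - x)), which turns the
  -- integral over `v` into that of a ₂F₁. Dividing `y` by the nonzero 1 - x does not change ε(y).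
  inner-integral-1 : ∀ A B′ C′ x y → ¬ F.1# F.- x F.≈ F.0# →
    ⟦ ε ⟧ y K.* ⟦ B′ · C′ ⟧ -1ᶠ K.* inner-integral A B′ C′ x y F.1#
      K.≈ ⟦ A ⁻¹ ⟧ (F.1# F.- x) K.* ₂F₁ A B′ C′ (y F.÷ (F.1# F.- x))
  inner-integral-1 A B′ C′ x y s≉0 = begin
      ⟦ ε ⟧ y K.* m K.* inner-integral A B′ C′ x y F.1#
        ≈⟨ K.*-cong (K.*-congʳ εy≈) (K.trans (∑-cong F.elements pointwise) (K.sym (∑-distribˡ F.elements _ _))) ⟩
      ⟦ ε ⟧ (y F.÷ s) K.* m K.* (⟦ A ⁻¹ ⟧ s K.* ∑ F.elements f)
        ≈⟨ solve 4 (λ e m a i → (e ⊕ m) ⊕ (a ⊕ i) ⊜ a ⊕ ((e ⊕ m) ⊕ i)) K.refl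
             (⟦ ε ⟧ (y F.÷ s)) m (⟦ A ⁻¹ ⟧ s) (∑ F.elements f) ⟩
      ⟦ A ⁻¹ ⟧ s K.* (⟦ ε ⟧ (y F.÷ s) K.* m K.* ∑ F.elements f)
        ≡⟨ ≡.cong (⟦ A ⁻¹ ⟧ s K.*_) (₂F₁≡ A B′ C′ (y F.÷ s)) ⟨
      ⟦ A ⁻¹ ⟧ s K.* ₂F₁ A B′ C′ (y F.÷ s) ∎
    where
    s = F.1# F.- x
    m = ⟦ B′ · C′ ⟧ -1ᶠ
    f : F.Carrier → K.Carrier
    f v = ⟦ B′ ⟧ v K.* ⟦ B′ ⁻¹ · C′ ⟧ (F.1# F.- v) K.* ⟦ A ⁻¹ ⟧ (F.1# F.- y F.÷ s F.* v)

    εy≈ : ⟦ ε ⟧ y K.≈ ⟦ ε ⟧ (y F.÷ s)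
    εy≈ = K.sym (ε-÷ y s≉0)

    factor : ∀ v → F.1# F.- F.1# F.* x F.- v F.* y F.≈ s F.* (F.1# F.- y F.÷ s F.* v)
    factor v = F.sym (F.trans (FRP.x[y-z]≈xy-xz s F.1# _) (F.+-cong
      (F.trans (F.*-identityʳ s) (F.+-congˡ (F.-‿cong (F.sym (F.*-identityˡ x)))))
      (F.-‿cong (F.trans (F.sym (F.*-assoc _ _ _)) (F.trans (F.*-congʳ (F.trans (F.*-comm _ _) (x÷z*z≈x s≉0)))
        (F.*-comm y v))))))

    pointwise : ∀ v →
      ⟦ B′ ⟧ v K.* ⟦ B′ ⁻¹ · C′ ⟧ (F.1# F.- v) K.* ⟦ A ⁻¹ ⟧ (F.1# F.- F.1# F.* x F.- v F.* y)
        K.≈ ⟦ A ⁻¹ ⟧ s K.* f v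
    pointwise v = K.trans (K.*-congˡ (K.trans (⟦⟧-cong (A ⁻¹) (factor v)) (homo (A ⁻¹) s _)))
      (solve 4 (λ b c a d → (b ⊕ c) ⊕ (a ⊕ d) ⊜ a ⊕ ((b ⊕ c) ⊕ d)) K.refl
        (⟦ B′ ⟧ v) (⟦ B′ ⁻¹ · C′ ⟧ (F.1# F.- v)) (⟦ A ⁻¹ ⟧ s) (⟦ A ⁻¹ ⟧ (F.1# F.- y F.÷ s F.* v)))

  module _ {N} (Θ : Enumeration characters N) (A B B′ C C′ : Character) (x y t : F.Carrier)
           (t≉1 : ¬ t F.≈ F.1#) (x≉1 : ¬ x F.≈ F.1#) where
    private
      s = F.1# F.- t
      s≉0 : ¬ s F.≈ F.0#
      s≉0 = x≉y⇒x-y≉0 (λ 1≈t → t≉1 (F.sym 1≈t))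
      1-x≉0 : ¬ F.1# F.- x F.≈ F.0#
      1-x≉0 = x≉y⇒x-y≉0 (λ 1≈x → x≉1 (F.sym 1≈x))
      h = inner-integral A B′ C′ x y
      m = ⟦ B · B′ · C · C′ ⟧ -1ᶠ
      κ = ⟦ ε ⟧ (x F.* y) K.* m

      summand : Character → K.Carrier
      summand θ = binom (B · C ⁻¹ · θ) θ K.* F₂ A (B · θ) B′ C C′ x y K.* ⟦ θ ⟧ t

      -- The sign character of the series for `B · θ` contains θ(-1); moved next to the integral, it
      -- leaves the prefactor `κ` independent of `θ`.
      summand≈ : ∀ θ → summand θ K.≈
        κ K.* (binom (B · C ⁻¹ · θ) θ K.* (⟦ θ ⟧ -1ᶠ K.* B-integral (B · θ) C h) K.* ⟦ θ ⟧ t)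
      summand≈ θ = K.trans (K.*-congʳ (K.*-congˡ (F₂≈B-integral A (B · θ) B′ C C′ x y)))
        (solve 9 (λ j e b o b′ c c′ i t →
            (j ⊕ ((e ⊕ ((((b ⊕ o) ⊕ b′) ⊕ c) ⊕ c′)) ⊕ i)) ⊕ t
              ⊜ (e ⊕ (((b ⊕ b′) ⊕ c) ⊕ c′)) ⊕ ((j ⊕ (o ⊕ i)) ⊕ t)) K.refl
          (binom (B · C ⁻¹ · θ) θ) (⟦ ε ⟧ (x F.* y)) (⟦ B ⟧ -1ᶠ) (⟦ θ ⟧ -1ᶠ) (⟦ B′ ⟧ -1ᶠ) (⟦ C ⟧ -1ᶠ) (⟦ C′ ⟧ -1ᶠ)
          (B-integral (B · θ) C h) (⟦ θ ⟧ t))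

      main-term : κ K.* (⟦ ε ⟧ t K.* (⟦ B ⁻¹ ⟧ s K.* B-integral B C (inner-integral A B′ C′ (x F.÷ s) y))) K.≈
        ⟦ ε ⟧ t K.* ⟦ B ⁻¹ ⟧ s K.* F₂ A B B′ C C′ (x F.÷ s) y
      main-term = begin
        ⟦ ε ⟧ (x F.* y) K.* m K.* (⟦ ε ⟧ t K.* (⟦ B ⁻¹ ⟧ s K.* i))
          ≈⟨ K.*-congʳ (K.*-congʳ (K.trans (homo ε x y) (K.trans (K.*-congʳ (K.sym (ε-÷ x s≉0))) (K.sym (homo ε (x F.÷ s) y))))) ⟩
        ⟦ ε ⟧ (x F.÷ s F.* y) K.* m K.* (⟦ ε ⟧ t K.* (⟦ B ⁻¹ ⟧ s K.* i))
          ≈⟨ solve 5 (λ e m t b i → (e ⊕ m) ⊕ (t ⊕ (b ⊕ i)) ⊜ (t ⊕ b) ⊕ ((e ⊕ m) ⊕ i)) K.refl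
               (⟦ ε ⟧ (x F.÷ s F.* y)) m (⟦ ε ⟧ t) (⟦ B ⁻¹ ⟧ s) i ⟩
        ⟦ ε ⟧ t K.* ⟦ B ⁻¹ ⟧ s K.* (⟦ ε ⟧ (x F.÷ s F.* y) K.* m K.* i)
          ≈⟨ K.*-congˡ (F₂≈B-integral A B B′ C C′ (x F.÷ s) y) ⟨
        ⟦ ε ⟧ t K.* ⟦ B ⁻¹ ⟧ s K.* F₂ A B B′ C C′ (x F.÷ s) y ∎
        where i = B-integral B C (inner-integral A B′ C′ (x F.÷ s) y)

      -- The element -1 is its own inverse, so `B` and `B ⁻¹` agree there.
      [B⁻¹C][-t] : ⟦ B ⁻¹ · C ⟧ (F.- t) K.≈ ⟦ B · C ⟧ -1ᶠ K.* ⟦ B ⁻¹ · C ⟧ t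
      [B⁻¹C][-t] = begin
        ⟦ B ⁻¹ · C ⟧ (F.- t)                        ≈⟨ ⟦⟧-cong (B ⁻¹ · C) (FRP.-1*x≈-x t) ⟨
        ⟦ B ⁻¹ · C ⟧ (-1ᶠ F.* t)                    ≈⟨ homo (B ⁻¹ · C) -1ᶠ t ⟩
        ⟦ B ⁻¹ · C ⟧ -1ᶠ K.* ⟦ B ⁻¹ · C ⟧ t         ≈⟨ K.*-congʳ (K.*-congʳ (⟦⟧-cong B (F.recip-unique -1*-1≈1))) ⟩
        ⟦ B · C ⟧ -1ᶠ K.* ⟦ B ⁻¹ · C ⟧ t            ∎

      -- The factor ε(t) is absorbed by `B ⁻¹ · C`, which vanishes at zero as well. Of ε(xy), the
      -- factor ε(x) stays outside and ε(y) becomes part of the ₂F₁.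
      boundary-term : κ K.* (⟦ ε ⟧ t K.* (⟦ B ⁻¹ · C ⟧ t K.* h F.1#)) K.≈
        ⟦ B ⁻¹ · C ⟧ (F.- t) K.* ⟦ ε ⟧ x K.* ⟦ A ⁻¹ ⟧ (F.1# F.- x) K.* ₂F₁ A B′ C′ (y F.÷ (F.1# F.- x))
      boundary-term = begin
        κ K.* (⟦ ε ⟧ t K.* (⟦ B ⁻¹ · C ⟧ t K.* h F.1#))
          ≈⟨ K.*-cong (K.*-congʳ (homo ε x y))
               (K.trans (K.sym (K.*-assoc _ _ _)) (K.*-congʳ (ε-identityˡ (B ⁻¹ · C) t))) ⟩
        ⟦ ε ⟧ x K.* ⟦ ε ⟧ y K.* m K.* (⟦ B ⁻¹ · C ⟧ t K.* h F.1#)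
          ≈⟨ solve 8 (λ ex ey b b′ c c′ t i →
                 ((ex ⊕ ey) ⊕ (((b ⊕ b′) ⊕ c) ⊕ c′)) ⊕ (t ⊕ i)
                   ⊜ (((b ⊕ c) ⊕ t) ⊕ ex) ⊕ ((ey ⊕ (b′ ⊕ c′)) ⊕ i)) K.refl
               (⟦ ε ⟧ x) (⟦ ε ⟧ y) (⟦ B ⟧ -1ᶠ) (⟦ B′ ⟧ -1ᶠ) (⟦ C ⟧ -1ᶠ) (⟦ C′ ⟧ -1ᶠ) (⟦ B ⁻¹ · C ⟧ t) (h F.1#) ⟩
        ⟦ B · C ⟧ -1ᶠ K.* ⟦ B ⁻¹ · C ⟧ t K.* ⟦ ε ⟧ x K.* (⟦ ε ⟧ y K.* ⟦ B′ · C′ ⟧ -1ᶠ K.* h F.1#)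
          ≈⟨ K.*-cong (K.*-congʳ (K.sym [B⁻¹C][-t])) (inner-integral-1 A B′ C′ x y 1-x≉0) ⟩
        ⟦ B ⁻¹ · C ⟧ (F.- t) K.* ⟦ ε ⟧ x K.* (⟦ A ⁻¹ ⟧ (F.1# F.- x) K.* ₂F₁ A B′ C′ (y F.÷ (F.1# F.- x)))
          ≈⟨ K.*-assoc _ _ _ ⟨
        ⟦ B ⁻¹ · C ⟧ (F.- t) K.* ⟦ ε ⟧ x K.* ⟦ A ⁻¹ ⟧ (F.1# F.- x) K.* ₂F₁ A B′ C′ (y F.÷ (F.1# F.- x)) ∎

    generating-function :
      1/[q-1] K.* K.sumOver Θ (λ θ → binom (B · C ⁻¹ · θ) θ K.* F₂ A (B · θ) B′ C C′ x y K.* ⟦ θ ⟧ t)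
        K.≈
      ⟦ ε ⟧ t K.* ⟦ B ⁻¹ ⟧ (F.1# F.- t) K.* F₂ A B B′ C C′ (x F.÷ (F.1# F.- t)) y
        K.- ⟦ B ⁻¹ · C ⟧ (F.- t) K.* ⟦ ε ⟧ x K.* ⟦ A ⁻¹ ⟧ (F.1# F.- x) K.* ₂F₁ A B′ C′ (y F.÷ (F.1# F.- x))
    generating-function = begin
      1/[q-1] K.* K.sumOver Θ summand
        ≡⟨ ≡.cong (1/[q-1] K.*_) (∑≡sumOver Θ summand) ⟨
      1/[q-1] K.* ∑ Θ summand
        ≈⟨ K.*-congˡ (K.trans (∑-cong Θ summand≈) (K.sym (∑-distribˡ Θ _ _))) ⟩
      1/[q-1] K.* (κ K.* ∑ Θ (λ θ → binom (B · C ⁻¹ · θ) θ K.* (⟦ θ ⟧ -1ᶠ K.* B-integral (B · θ) C h) K.* ⟦ θ ⟧ t))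
        ≈⟨ x∙yz≈y∙xz _ _ _ ⟩
      κ K.* (1/[q-1] K.* ∑ Θ (λ θ → binom (B · C ⁻¹ · θ) θ K.* (⟦ θ ⟧ -1ᶠ K.* B-integral (B · θ) C h) K.* ⟦ θ ⟧ t))
        ≈⟨ K.*-congˡ (θ-average Θ B C t h (λ u≈v → inner-integral-cong A B′ C′ (F.*-congʳ u≈v))) ⟩
      κ K.* (⟦ ε ⟧ t K.* (i K.- ⟦ B ⁻¹ · C ⟧ t K.* h F.1#))
        ≈⟨ K.*-congˡ (KRP.x[y-z]≈xy-xz _ _ _) ⟩
      κ K.* (⟦ ε ⟧ t K.* i K.- ⟦ ε ⟧ t K.* (⟦ B ⁻¹ · C ⟧ t K.* h F.1#))
        ≈⟨ KRP.x[y-z]≈xy-xz _ _ _ ⟩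
      κ K.* (⟦ ε ⟧ t K.* i) K.- κ K.* (⟦ ε ⟧ t K.* (⟦ B ⁻¹ · C ⟧ t K.* h F.1#))
        ≈⟨ K.+-cong (K.trans (K.*-congˡ (K.*-congˡ (B-integral-rescale A B C B′ C′ x y s≉0))) main-term)
             (K.-‿cong boundary-term) ⟩
      ⟦ ε ⟧ t K.* ⟦ B ⁻¹ ⟧ s K.* F₂ A B B′ C C′ (x F.÷ s) y
        K.- ⟦ B ⁻¹ · C ⟧ (F.- t) K.* ⟦ ε ⟧ x K.* ⟦ A ⁻¹ ⟧ (F.1# F.- x) K.* ₂F₁ A B′ C′ (y F.÷ (F.1# F.- x)) ∎
      where
      open CommutativeSemigroupProperties K.*-commutativeSemigroup using (x∙yz≈y∙xz)
      i = ∑ F.elements (λ u → ⟦ B ⟧ u K.* ⟦ B ⁻¹ · C ⟧ (F.1# F.- u F.* s) K.* h u)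

theorem4p2 : ∀ {c ℓ₁ ℓ₂ k ℓ₃ ℓ₄} (𝔽 : FiniteField c ℓ₁ ℓ₂) (𝕂 : ValueField k ℓ₃ ℓ₄) →
    let open Appell 𝔽 𝕂 in
    ∀ {N} (Θ : Enumeration characters N)
    (A B B′ C C′ : Character) (x y t : F.Carrier) → ¬ (t F.≈ F.1#) →
    (¬ (x F.≈ F.1#) →
    1/[q-1] K.* K.sumOver Θ (λ θ → binom (B · C ⁻¹ · θ) θ K.* F₂ A (B · θ) B′ C C′ x y K.* ⟦ θ ⟧ t)
    K.≈
    ⟦ ε ⟧ t K.* ⟦ B ⁻¹ ⟧ (F.1# F.- t) K.* F₂ A B B′ C C′ (x F.÷ (F.1# F.- t)) y
    K.- ⟦ B ⁻¹ · C ⟧ (F.- t) K.* ⟦ ε ⟧ x K.* ⟦ A ⁻¹ ⟧ (F.1# F.- x) K.* ₂F₁ A B′ C′ (y F.÷ (F.1# F.- x)))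
    ×
    (¬ (y F.≈ F.1#) →
    1/[q-1] K.* K.sumOver Θ (λ θ → binom (B′ · C′ ⁻¹ · θ) θ K.* F₂ A B (B′ · θ) C C′ x y K.* ⟦ θ ⟧ t)
    K.≈
    ⟦ ε ⟧ t K.* ⟦ B′ ⁻¹ ⟧ (F.1# F.- t) K.* F₂ A B B′ C C′ x (y F.÷ (F.1# F.- t))
    K.- ⟦ B′ ⁻¹ · C′ ⟧ (F.- t) K.* ⟦ ε ⟧ y K.* ⟦ A ⁻¹ ⟧ (F.1# F.- y) K.* ₂F₁ A B C (x F.÷ (F.1# F.- y)))
theorem4p2 𝔽 𝕂 Θ A B B′ C C′ x y t t≉1 =
    generating-function Θ A B B′ C C′ x y t t≉1 ,
    -- The symmetry is applied under the sum, the first formula is used with the two variables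
    -- exchanged, and the main term is swapped back; the boundary term already has the required
    -- form.
    λ y≉1 → begin
      1/[q-1] K.* K.sumOver Θ (λ θ → binom (B′ · C′ ⁻¹ · θ) θ K.* F₂ A B (B′ · θ) C C′ x y K.* ⟦ θ ⟧ t)
        ≡⟨ ≡.cong (1/[q-1] K.*_) (∑≡sumOver Θ _) ⟨
      1/[q-1] K.* ∑ Θ (λ θ → binom (B′ · C′ ⁻¹ · θ) θ K.* F₂ A B (B′ · θ) C C′ x y K.* ⟦ θ ⟧ t)
        ≈⟨ K.*-congˡ (∑-cong Θ λ θ → K.*-congʳ (K.*-congˡ (F₂-swap A B (B′ · θ) C C′ x y))) ⟩
      1/[q-1] K.* ∑ Θ (λ θ → binom (B′ · C′ ⁻¹ · θ) θ K.* F₂ A (B′ · θ) B C′ C y x K.* ⟦ θ ⟧ t)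
        ≡⟨ ≡.cong (1/[q-1] K.*_) (∑≡sumOver Θ _) ⟩
      1/[q-1] K.* K.sumOver Θ (λ θ → binom (B′ · C′ ⁻¹ · θ) θ K.* F₂ A (B′ · θ) B C′ C y x K.* ⟦ θ ⟧ t)
        ≈⟨ generating-function Θ A B′ B C′ C y x t t≉1 y≉1 ⟩
      ⟦ ε ⟧ t K.* ⟦ B′ ⁻¹ ⟧ (F.1# F.- t) K.* F₂ A B′ B C′ C (y F.÷ (F.1# F.- t)) x K.- _
        ≈⟨ K.+-congʳ (K.*-congˡ (F₂-swap A B′ B C′ C (y F.÷ (F.1# F.- t)) x)) ⟩
      ⟦ ε ⟧ t K.* ⟦ B′ ⁻¹ ⟧ (F.1# F.- t) K.* F₂ A B B′ C C′ x (y F.÷ (F.1# F.- t)) K.- _ ∎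
  where
  open Appell 𝔽 𝕂
  open EnumerationSums 𝕂
  open GeneratingFunction 𝔽 𝕂
  open ≈-Reasoning K.setoid
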